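{- There exists an algorithm that, given an integer $k\ge 1$ and an $n$-vertex graph $G$ together with a $w$-expression (of size polynomial in $n$ and $w$) whose underlying unlabelled graph is $G$, computes the number of equitable $k$-colorings of $G$ in time $2^{O(k\cdot w)}\cdot n^{O(k)}$. In particular, for every fixed $k$, counting equitable $k$-colorings is polynomial-time solvable on every graph class of bounded clique-width, when a clique-width expression is given with the input.
   Context: Graphs are finite, without loops or parallel edges. A $k$-coloring of $G$ is a map $\varphi:V(G)\to[k]=\{1,\dots,k\}$ with $\varphi(u)\ne\varphi(v)$ for every edge $uv$ (i.e. it is proper); it is equitable if $\bigl||\varphi^{ -1}(i)|-|\varphi^{ -1}(j)|\bigr|\le 1$ for all $i,j\in[k]$. Colorings are counted as maps. For $w\ge 1$, a $w$-labelled graph is a graph $G$ together with a labelling function $\mathrm{lab}:V(G)\to[w]$. A $w$-expression is a valid term built from the following operations on $w$-labelled graphs: (1) for $i\in[w]$, introduce a single-vertex graph whose vertex has label $i$; (2) the disjoint union of two $w$-labelled graphs; (3) for distinct $i,j\in[w]$, relabel: change the label of every vertex of label $i$ to $j$; (4) for distinct $i,j\in[w]$, join: add all edges with one endpoint of label $i$ and the other of label $j$. The clique-width $\mathrm{cw}(G)$ is the least $w$ such that some $w$-expression has underlying unlabelled graph $G$. A graph class has bounded clique-width if there is a constant $c$ with $\mathrm{cw}(G)\le c$ for all $G$ in the class. -}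

module Defs where

open import Data.Bool.Base using (Bool; true; false; _∧_; _∨_; if_then_else_)
open import Data.Bool.Properties using (∨-comm)
import Data.Bool.Properties as Bool
open import Data.Fin.Base using (Fin; zero; suc; toℕ; splitAt; finToFun)
open import Data.Fin.Properties using (_≟_; all?)
open import Data.List.Base using (List; []; _∷_; length; filter; allFin; tabulate)
open import Data.Nat.Base using (ℕ; zero; suc; _+_; _*_; _^_; _≤_; ∣_-_∣)
open import Data.Nat.Properties using (_≤?_)
open import Data.Nat.Binary.Base using (ℕᵇ; 2[1+_]; 1+[2_]; fromℕ)
open import Data.Product.Base using (_×_; ∃-syntax)
open import Data.Sum.Base using (_⊎_; inj₁; inj₂; [_,_]′)
open import Data.Vec.Base using (Vec; []; _∷_; lookup)
open import Function.Base using (_∘_)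
open import Function.Bundles using (_↔_; module Inverse)
open import Relation.Binary.PropositionalEquality
  using (_≡_; _≢_; refl; sym; trans; cong₂)
open import Relation.Nullary.Decidable using (Dec; yes; no; ⌊_⌋; ¬?; _→-dec_; _×-dec_)
open import Relation.Nullary.Negation.Core using (contradiction)

------------------------------------------------------------------------
-- Graphs and colorings

record Graph (n : ℕ) : Set where
  field
    adj    : Fin n → Fin n → Bool
    symm   : ∀ u v → adj u v ≡ adj v u
    irrefl : ∀ v → adj v v ≡ false

open Graph public

record _≅_ {m n : ℕ} (G : Graph m) (H : Graph n) : Set where
  field
    bijection : Fin m ↔ Fin n
    preserves : ∀ u v → adj G u v
                      ≡ adj H (Inverse.to bijection u) (Inverse.to bijection v)

Map : ℕ → ℕ → Set
Map n k = Fin n → Fin k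

Proper : ∀ {n k} → Graph n → Map n k → Set
Proper G φ = ∀ u v → adj G u v ≡ true → φ u ≢ φ v

classSize : ∀ {n k} → Map n k → Fin k → ℕ
classSize φ i = length (filter (λ v → φ v ≟ i) (allFin _))

Equitable : ∀ {n k} → Map n k → Set
Equitable φ = ∀ i j → ∣ classSize φ i - classSize φ j ∣ ≤ 1

EquitableColoring : ∀ {n k} → Graph n → Map n k → Set
EquitableColoring G φ = Proper G φ × Equitable φ

equitableColoring? : ∀ {n k} (G : Graph n) (φ : Map n k) →
                     Dec (EquitableColoring G φ)
equitableColoring? G φ =
  all? (λ u → all? (λ v → (adj G u v Bool.≟ true) →-dec ¬? (φ u ≟ φ v)))
  ×-dec
  all? (λ i → all? (λ j → ∣ classSize φ i - classSize φ j ∣ ≤? 1))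

-- finToFun is a bijection from Fin (k ^ n) onto the maps Fin n → Fin k
-- (up to pointwise equality), so each map is counted exactly once.
#equitableColorings : ∀ {n} → ℕ → Graph n → ℕ
#equitableColorings {n} k G =
  length (filter (λ c → equitableColoring? G (finToFun {k} {n} c)) (allFin (k ^ n)))

------------------------------------------------------------------------
-- Clique-width

record LabelledGraph (w : ℕ) : Set where
  field
    order : ℕ
    graph : Graph order
    lab   : Fin order → Fin w

open LabelledGraph public

data Expr (w : ℕ) : Set where
  intro   : Fin w → Expr w
  _⊕_     : Expr w → Expr w → Expr w
  relabel : (i j : Fin w) → i ≢ j → Expr w → Expr w
  join    : (i j : Fin w) → i ≢ j → Expr w → Expr w

size : ∀ {w} → Expr w → ℕ
size (intro i)         = 1
size (e ⊕ f)           = suc (size e + size f)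
size (relabel i j _ e) = suc (size e)
size (join i j _ e)    = suc (size e)

introᴳ : ∀ {w} → Fin w → LabelledGraph w
introᴳ i .order             = 1
introᴳ i .graph .adj _ _    = false
introᴳ i .graph .symm _ _   = refl
introᴳ i .graph .irrefl _   = refl
introᴳ i .lab _             = i

module _ {m n : ℕ} (G : Graph m) (H : Graph n) where

  adj⊎ : Fin m ⊎ Fin n → Fin m ⊎ Fin n → Bool
  adj⊎ (inj₁ u) (inj₁ v) = adj G u v
  adj⊎ (inj₂ u) (inj₂ v) = adj H u v
  adj⊎ _        _        = false

  symm⊎ : ∀ x y → adj⊎ x y ≡ adj⊎ y x
  symm⊎ (inj₁ u) (inj₁ v) = symm G u v
  symm⊎ (inj₁ u) (inj₂ v) = refl
  symm⊎ (inj₂ u) (inj₁ v) = refl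
  symm⊎ (inj₂ u) (inj₂ v) = symm H u v

  irrefl⊎ : ∀ x → adj⊎ x x ≡ false
  irrefl⊎ (inj₁ u) = irrefl G u
  irrefl⊎ (inj₂ v) = irrefl H v

_⊕ᴳ_ : ∀ {w} → LabelledGraph w → LabelledGraph w → LabelledGraph w
(G ⊕ᴳ H) .order           = order G + order H
(G ⊕ᴳ H) .graph .adj u v  =
  adj⊎ (graph G) (graph H) (splitAt (order G) u) (splitAt (order G) v)
(G ⊕ᴳ H) .graph .symm u v =
  symm⊎ (graph G) (graph H) (splitAt (order G) u) (splitAt (order G) v)
(G ⊕ᴳ H) .graph .irrefl v = irrefl⊎ (graph G) (graph H) (splitAt (order G) v)
(G ⊕ᴳ H) .lab v           = [ lab G , lab H ]′ (splitAt (order G) v)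

relabelᴳ : ∀ {w} → Fin w → Fin w → LabelledGraph w → LabelledGraph w
relabelᴳ i j G .order = order G
relabelᴳ i j G .graph = graph G
relabelᴳ i j G .lab v = if ⌊ lab G v ≟ i ⌋ then j else lab G v

module _ {w : ℕ} (i j : Fin w) where

  joins : Fin w → Fin w → Bool
  joins a b = (⌊ a ≟ i ⌋ ∧ ⌊ b ≟ j ⌋) ∨ (⌊ b ≟ i ⌋ ∧ ⌊ a ≟ j ⌋)

  joins-symm : ∀ a b → joins a b ≡ joins b a
  joins-symm a b = ∨-comm (⌊ a ≟ i ⌋ ∧ ⌊ b ≟ j ⌋) (⌊ b ≟ i ⌋ ∧ ⌊ a ≟ j ⌋)

  joins-irrefl : i ≢ j → ∀ a → joins a a ≡ false
  joins-irrefl i≢j a with a ≟ i | a ≟ j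
  ... | yes p | yes q = contradiction (trans (sym p) q) i≢j
  ... | yes _ | no  _ = refl
  ... | no  _ | yes _ = refl
  ... | no  _ | no  _ = refl

joinᴳ : ∀ {w} (i j : Fin w) → i ≢ j → LabelledGraph w → LabelledGraph w
joinᴳ i j i≢j G .order            = order G
joinᴳ i j i≢j G .graph .adj u v   = adj (graph G) u v ∨ joins i j (lab G u) (lab G v)
joinᴳ i j i≢j G .graph .symm u v  =
  cong₂ _∨_ (symm (graph G) u v) (joins-symm i j (lab G u) (lab G v))
joinᴳ i j i≢j G .graph .irrefl v  =
  cong₂ _∨_ (irrefl (graph G) v) (joins-irrefl i j i≢j (lab G v))
joinᴳ i j i≢j G .lab              = lab G

⟦_⟧ : ∀ {w} → Expr w → LabelledGraph w
⟦ intro i ⟧           = introᴳ i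
⟦ e ⊕ f ⟧             = ⟦ e ⟧ ⊕ᴳ ⟦ f ⟧
⟦ relabel i j _ e ⟧   = relabelᴳ i j ⟦ e ⟧
⟦ join i j i≢j e ⟧    = joinᴳ i j i≢j ⟦ e ⟧

-- Vertices of a term have no names of their own, hence "up to isomorphism".
_Builds_ : ∀ {w n} → Expr w → Graph n → Set
e Builds G = graph ⟦ e ⟧ ≅ G

HasExpr : ∀ {n} → Graph n → ℕ → Set
HasExpr G w = ∃[ e ] _Builds_ {w} e G

IsCliqueWidth : ∀ {n} → Graph n → ℕ → Set
IsCliqueWidth G w = HasExpr G w × (∀ v → HasExpr G v → w ≤ v)

GraphClass : Set₁
GraphClass = ∀ {n} → Graph n → Set

CliqueWidthBoundedBy : ℕ → GraphClass → Set
CliqueWidthBoundedBy c 𝒢 =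
  ∀ {n} (G : Graph n) → 𝒢 G → ∀ w → IsCliqueWidth G w → w ≤ c

------------------------------------------------------------------------
-- Model of computation: a strict first-order functional language with general
-- recursion whose only data are binary trees (pure first-order LISP over the
-- single atom nil).  Every evaluation step has unit cost.  As trees can be
-- shared by pointers and a program has a fixed number of procedures and
-- variables, a step takes constant time on a pointer machine, so running times
-- agree with Turing machine times up to a polynomial.

infixr 5 _∙_

data Tree : Set where
  nil : Tree
  _∙_ : Tree → Tree → Tree

treeSize : Tree → ℕ
treeSize nil     = 1
treeSize (s ∙ t) = suc (treeSize s + treeSize t)

-- Terms in m variables (de Bruijn indices); procedure f takes arity f arguments.
data Term {p : ℕ} (arity : Fin p → ℕ) (m : ℕ) : Set where
  var  : Fin m → Term arity m
  nil  : Term arity m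
  cons : Term arity m → Term arity m → Term arity m
  -- case s a b: if s is nil then a, otherwise b with variable 0 bound to the
  -- left and variable 1 to the right subtree of s.
  case : Term arity m → Term arity m → Term arity (2 + m) → Term arity m
  bind : Term arity m → Term arity (1 + m) → Term arity m
  call : (f : Fin p) → Vec (Term arity m) (arity f) → Term arity m

record Program : Set where
  field
    procedures : ℕ
    arity      : Fin procedures → ℕ
    body       : (f : Fin procedures) → Term arity (arity f)
    main       : Term arity 1

module Evaluation (P : Program) where

  open Program P

  infix 4 _⊢_⇓_cost_ _⊢*_⇓_cost_

  mutual

    data _⊢_⇓_cost_ {m : ℕ} (ρ : Vec Tree m) : Term arity m → Tree → ℕ → Set where

      var  : ∀ x → ρ ⊢ var x ⇓ lookup ρ x cost 1

      nil  : ρ ⊢ nil ⇓ nil cost 1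

      cons : ∀ {a b u v s t} →
             ρ ⊢ a ⇓ u cost s → ρ ⊢ b ⇓ v cost t →
             ρ ⊢ cons a b ⇓ u ∙ v cost suc (s + t)

      case-nil  : ∀ {e a b v s t} →
                  ρ ⊢ e ⇓ nil cost s → ρ ⊢ a ⇓ v cost t →
                  ρ ⊢ case e a b ⇓ v cost suc (s + t)

      case-cons : ∀ {e a b l r v s t} →
                  ρ ⊢ e ⇓ l ∙ r cost s → l ∷ r ∷ ρ ⊢ b ⇓ v cost t →
                  ρ ⊢ case e a b ⇓ v cost suc (s + t)

      bind : ∀ {a b u v s t} →
             ρ ⊢ a ⇓ u cost s → u ∷ ρ ⊢ b ⇓ v cost t →
             ρ ⊢ bind a b ⇓ v cost suc (s + t)

      call : ∀ {f as vs v s t} →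
             ρ ⊢* as ⇓ vs cost s → vs ⊢ body f ⇓ v cost t →
             ρ ⊢ call f as ⇓ v cost suc (s + t)

    data _⊢*_⇓_cost_ {m : ℕ} (ρ : Vec Tree m) :
         ∀ {l} → Vec (Term arity m) l → Vec Tree l → ℕ → Set where

      []  : ρ ⊢* [] ⇓ [] cost 0

      _∷_ : ∀ {l a v s t} {as : Vec (Term arity m) l} {vs} →
            ρ ⊢ a ⇓ v cost s → ρ ⊢* as ⇓ vs cost t →
            ρ ⊢* a ∷ as ⇓ v ∷ vs cost s + t

_On_Outputs_Within_ : Program → Tree → Tree → ℕ → Set
P On x Outputs y Within b = ∃[ t ] t ≤ b × (x ∷ []) ⊢ main ⇓ y cost t
  where open Program P; open Evaluation P

------------------------------------------------------------------------
-- Input and output conventions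

-- Numbers are written in (bijective) binary, least significant digit first.
⌜_⌝ᵇ : ℕᵇ → Tree
⌜ ℕᵇ.zero ⌝ᵇ  = nil
⌜ 1+[2 x ] ⌝ᵇ = nil ∙ ⌜ x ⌝ᵇ
⌜ 2[1+ x ] ⌝ᵇ = (nil ∙ nil) ∙ ⌜ x ⌝ᵇ

⌜_⌝ : ℕ → Tree
⌜ n ⌝ = ⌜ fromℕ n ⌝ᵇ

encodeBool : Bool → Tree
encodeBool false = nil
encodeBool true  = nil ∙ nil

encodeList : ∀ {A : Set} → (A → Tree) → List A → Tree
encodeList f []       = nil
encodeList f (x ∷ xs) = f x ∙ encodeList f xs

-- The adjacency matrix, row by row.
encodeGraph : ∀ {n} → Graph n → Tree
encodeGraph G = encodeList (encodeList encodeBool) (tabulate (tabulate ∘ adj G))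

encodeExpr : ∀ {w} → Expr w → Tree
encodeExpr (intro i)         = ⌜ 0 ⌝ ∙ ⌜ toℕ i ⌝
encodeExpr (e ⊕ f)           = ⌜ 1 ⌝ ∙ encodeExpr e ∙ encodeExpr f
encodeExpr (relabel i j _ e) = ⌜ 2 ⌝ ∙ ⌜ toℕ i ⌝ ∙ ⌜ toℕ j ⌝ ∙ encodeExpr e
encodeExpr (join i j _ e)    = ⌜ 3 ⌝ ∙ ⌜ toℕ i ⌝ ∙ ⌜ toℕ j ⌝ ∙ encodeExpr e

encodeInput : ∀ {n w} → ℕ → Graph n → Expr w → Tree
encodeInput {w = w} k G e = ⌜ k ⌝ ∙ ⌜ w ⌝ ∙ encodeGraph G ∙ encodeExpr e

CountsEquitableColorings : Program → ∀ {n w} → ℕ → Graph n → Expr w → ℕ → Set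
CountsEquitableColorings P k G e b =
  P On encodeInput k G e Outputs ⌜ #equitableColorings k G ⌝ Within b

{-# OPTIONS --safe #-}

-- Dynamic programming along the expression.  The signature of a coloring lists,
-- for each color, the size of its class and the set of labels occurring in it;
-- properness at a join and the signature at every operation depend only on the
-- signatures of the operands.  There are at most ((n + 1) * 2 ^ (w + 1)) ^ k
-- signatures, and the table of an expression stores how many proper colorings
-- have each of them, so every operation takes time polynomial in that number
-- and in the number of binary digits of k ^ n.

module Submission where

open import Defs

import Algebra.Properties.CommutativeMonoid.Sum
open import Data.Bool.Base using (Bool; true; false; _∧_; _∨_; not; if_then_else_)
open import Data.Bool.Properties as Bool using (∧-zeroʳ; ∨-zeroʳ; ∨-identityʳ)
open import Data.Fin using (#_)
open import Data.Fin.Base as Fin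
  using (Fin; zero; suc; toℕ; splitAt; finToFun; funToFin; _↑ˡ_; _↑ʳ_)
open import Data.Fin.Permutation using (Permutation; _⟨$⟩ʳ_; ↔⇒≡)
open import Data.Fin.Properties as Fin using (all?; injective⇒≤; toℕ<n; toℕ-injective)
open import Data.List.Base as List using (List; []; _∷_; length; filter; tabulate)
open import Data.List.Membership.Propositional using (_∈_)
open import Data.List.Membership.Propositional.Properties
  using (∈-lookup; ∈-++⁺ˡ; ∈-++⁺ʳ; ∈-map⁺; ∈-upTo⁺; ∈-cartesianProduct⁺; ∈-cartesianProductWith⁺)
import Data.List.Properties as List
open import Data.List.Relation.Unary.All as All using (All; []; _∷_)
open import Data.List.Relation.Unary.AllPairs using (AllPairs; []; _∷_)
open import Data.List.Relation.Unary.Any as Any using (here; there)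
import Data.List.Relation.Unary.Any.Properties as Any
open import Data.Nat.Base
  using (ℕ; zero; suc; _+_; _*_; _^_; _≤_; _<_; z≤n; s≤s; ∣_-_∣; >-nonZero)
open import Data.Nat.Binary.Base as ᵇ using (2[1+_]; 1+[2_]; fromℕ)
import Data.Nat.Binary.Properties as ᵇ
open import Data.Nat.Properties
open import Data.Nat.Tactic.RingSolver using (solve-∀)
open import Data.Product.Base using (_×_; _,_; ∃-syntax; proj₁; proj₂)
open import Data.Product.Properties using () renaming (≡-dec to ×-≡-dec)
open import Data.Sum.Base using (_⊎_; inj₁; inj₂; [_,_]′)
open import Data.Vec.Base as Vec using (Vec; []; _∷_; lookup; take; drop; _++_)
import Data.Vec.Functional as Func
import Data.Vec.Properties as Vec
open import Data.Vec.Relation.Unary.All as VecAll using ([]; _∷_) renaming (All to VecAll)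
open import Data.Vec.Relation.Unary.All.Properties using (lookup⁺)
open import Function.Base using (_∘_; id)
open import Function.Bundles using (_↔_; _⇔_; mk⇔; mk↔ₛ′; Inverse; Equivalence)
open import Relation.Binary.Definitions using (DecidableEquality)
open import Relation.Binary.PropositionalEquality
open import Relation.Nullary.Decidable
  using (Dec; yes; no; does; ⌊_⌋; True; from-yes; dec-true; dec-false; does-⇔; isYes≗does)
open import Relation.Nullary.Negation.Core using (contradiction; ¬_)

-- The obstacle is the running time of a concrete program: every intermediate number must be bounded
-- before its digits can be counted. All quantities are compared with one `M`, the square of a bound
-- on the number of keys plus the size of the expression. The square leaves room for the digits of
-- `k ^ n`. Every procedure makes polynomially many calls in `M`, so the total is a power of a
-- quantity that is itself of the form `2 ^ O(k * w) * n ^ O(k)` for expressions of polynomial size.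
-- The counters stay small because `mass`, the number of colorings held in a table, is at most
-- `k ^ n`, and the loops that fill a table never increase the sum of what is stored and what is
-- still to be inserted. Bit lists may end in zeros, so relabelling does not have to normalize them.
-- One set may then occur under several keys. This splits a row but changes no sum over the table,
-- and costs only the passage from `2 ^ w` sets to fewer than `2 ^ (w + 1)` codes.

mutual

  -- Bounds the steps that one body takes outside the calls it makes: a term contains no loops, so
  -- each subterm is evaluated at most once.
  termSize : ∀ {p m} {arity : Fin p → ℕ} → Term arity m → ℕ
  termSize (var _)      = 1
  termSize nil          = 1
  termSize (cons a b)   = suc (termSize a + termSize b)
  termSize (case e a b) = suc (termSize e + (termSize a + termSize b))
  termSize (bind a b)   = suc (termSize a + termSize b)
  termSize (call _ as)  = suc (termsSize as)

  termsSize : ∀ {p m l} {arity : Fin p → ℕ} → Vec (Term arity m) l → ℕ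
  termsSize []       = 0
  termsSize (a ∷ as) = termSize a + termsSize as

-- Up to a constant factor the cost of an evaluation is its number of procedure
-- calls, so only calls are counted.  A term denotes, in continuation-passing
-- style, the tree of calls it makes; for a concrete argument the rest of its
-- evaluation is carried out by the type checker.
module CallCounting (P : Program) (K : ℕ) (bodies≤K : ∀ f → termSize (Program.body P f) ≤ K) where

  open Program P
  open Evaluation P

  data Comp : Set where
    ret : Tree → Comp
    ask : (f : Fin procedures) → Vec Tree (arity f) → (Tree → Comp) → Comp

  branch : Comp → (Tree → Tree → Comp) → Tree → Comp
  branch n c nil     = n
  branch n c (l ∙ r) = c l r

  mutual

    den : ∀ {m} → Term arity m → Vec Tree m → (Tree → Comp) → Comp
    den (var x)      ρ κ = κ (lookup ρ x)
    den nil          ρ κ = κ nil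
    den (cons a b)   ρ κ = den a ρ λ u → den b ρ λ v → κ (u ∙ v)
    den (case e a b) ρ κ = den e ρ (branch (den a ρ κ) λ l r → den b (l ∷ r ∷ ρ) κ)
    den (bind a b)   ρ κ = den a ρ λ u → den b (u ∷ ρ) κ
    den (call f as)  ρ κ = den* as ρ λ vs → ask f vs κ

    den* : ∀ {m l} → Vec (Term arity m) l → Vec Tree m → (Vec Tree l → Comp) → Comp
    den* []       ρ κ = κ []
    den* (a ∷ as) ρ κ = den a ρ λ u → den* as ρ λ us → κ (u ∷ us)

  infix 4 _$_⇓_⟨_⟩

  -- The count `s` includes the call of `f` itself. Each call thereby pays for `K` steps, the most
  -- that its own body can take; see `proc`.
  record _$_⇓_⟨_⟩ (f : Fin procedures) (vs : Vec Tree (arity f)) (v : Tree) (s : ℕ) : Set where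
    constructor runs
    field
      {time}     : ℕ
      bound      : time ≤ K * s
      derivation : vs ⊢ body f ⇓ v cost time

  infixr 5 _⨾_

  data Runs : Comp → Tree → ℕ → Set where
    ret : ∀ {v} → Runs (ret v) v 0
    _⨾_ : ∀ {f vs κ u v s t} → f $ vs ⇓ u ⟨ s ⟩ → Runs (κ u) v t →
          Runs (ask f vs κ) v (s + t)

  -- Closes a sequence of calls without the summand 0 that a final `ret` would leave in the bound.
  -- The equation is usually `refl`: there the type checker runs the program from the last call to
  -- its end.
  last : ∀ {f vs κ u v s} → f $ vs ⇓ u ⟨ s ⟩ → κ u ≡ ret v → Runs (ask f vs κ) v s
  last {κ = κ} {u} {v} {s} p eq =
    subst (Runs _ v) (+-identityʳ s) (p ⨾ subst (λ c → Runs c v 0) (sym eq) ret)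

  -- The induction hypothesis for an arbitrary continuation: a run of `den e ρ κ` splits into an
  -- evaluation of `e` and a run of what `κ` does with its value, and the calls are divided between
  -- the two.
  record Evaluates {A : Set} (_⇓_ : A → ℕ → Set) (size : ℕ) (κ : A → Comp)
                   (v : Tree) (b : ℕ) : Set where
    constructor evaluates
    field
      {value}     : A
      {time}      : ℕ
      {used rest} : ℕ
      derivation  : value ⇓ time
      bound       : time ≤ size + K * used
      remaining   : Runs (κ value) v rest
      split       : used + rest ≡ b

  private
    add-bounds : ∀ {s t} a b x y → s ≤ a + K * x → t ≤ b + K * y →
                 s + t ≤ (a + b) + K * (x + y)
    add-bounds a b x y p q = ≤-trans (+-mono-≤ p q) (≤-reflexive (rearrange a b x y K))
      where
      rearrange : ∀ a b x y k → (a + k * x) + (b + k * y) ≡ (a + b) + k * (x + y)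
      rearrange = solve-∀

    assoc : ∀ x {y z m b} → y + z ≡ m → x + m ≡ b → (x + y) + z ≡ b
    assoc x {y} {z} refl q = trans (+-assoc x y z) q

  mutual

    den-sound : ∀ {m} (e : Term arity m) ρ κ {v b} → Runs (den e ρ κ) v b →
                Evaluates (ρ ⊢ e ⇓_cost_) (termSize e) κ v b
    den-sound (var x) ρ κ r = evaluates {used = 0} (var x) (m≤m+n 1 _) r refl
    den-sound nil     ρ κ r = evaluates {used = 0} nil (m≤m+n 1 _) r refl
    den-sound (cons a b) ρ κ r with den-sound a ρ _ r
    ... | evaluates {used = x} p p≤ r₁ e₁ with den-sound b ρ _ r₁
    ... | evaluates {used = y} q q≤ r₂ e₂ =
      evaluates (cons p q) (s≤s (add-bounds (termSize a) (termSize b) x y p≤ q≤)) r₂ (assoc x e₂ e₁)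
    den-sound (case e a b) ρ κ r with den-sound e ρ _ r
    ... | evaluates {nil} {used = x} p p≤ r₁ e₁ with den-sound a ρ κ r₁
    ... | evaluates {used = y} q q≤ r₂ e₂ =
      evaluates (case-nil p q)
        (s≤s (add-bounds (termSize e) _ x y p≤
          (≤-trans q≤ (+-monoˡ-≤ _ (m≤m+n (termSize a) (termSize b)))))) r₂ (assoc x e₂ e₁)
    den-sound (case e a b) ρ κ r | evaluates {l ∙ r′} {used = x} p p≤ r₁ e₁
      with den-sound b (l ∷ r′ ∷ ρ) κ r₁
    ... | evaluates {used = y} q q≤ r₂ e₂ =
      evaluates (case-cons p q)
        (s≤s (add-bounds (termSize e) _ x y p≤
          (≤-trans q≤ (+-monoˡ-≤ _ (m≤n+m (termSize b) (termSize a)))))) r₂ (assoc x e₂ e₁)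
    den-sound (bind a b) ρ κ r with den-sound a ρ _ r
    ... | evaluates {u} {used = x} p p≤ r₁ e₁ with den-sound b (u ∷ ρ) κ r₁
    ... | evaluates {used = y} q q≤ r₂ e₂ =
      evaluates (bind p q) (s≤s (add-bounds (termSize a) (termSize b) x y p≤ q≤)) r₂ (assoc x e₂ e₁)
    den-sound (call f as) ρ κ r with den*-sound as ρ _ r
    ... | evaluates {used = x} ps ps≤ (_⨾_ {s = s} {t = z} (runs t≤ q) r₁) e₁ =
      evaluates {used = x + s} (call ps q)
        (s≤s (≤-trans (add-bounds (termsSize as) 0 x s ps≤ t≤)
               (≤-reflexive (cong (_+ K * (x + s)) (+-identityʳ (termsSize as))))))
        r₁ (assoc x refl e₁)

    den*-sound : ∀ {m l} (as : Vec (Term arity m) l) ρ κ {v b} → Runs (den* as ρ κ) v b →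
                 Evaluates (ρ ⊢* as ⇓_cost_) (termsSize as) κ v b
    den*-sound []       ρ κ r = evaluates {used = 0} [] z≤n r refl
    den*-sound (a ∷ as) ρ κ r with den-sound a ρ _ r
    ... | evaluates {used = x} p p≤ r₁ e₁ with den*-sound as ρ _ r₁
    ... | evaluates {used = y} q q≤ r₂ e₂ =
      evaluates (p ∷ q) (add-bounds (termSize a) (termsSize as) x y p≤ q≤) r₂ (assoc x e₂ e₁)

  run : ∀ {m} (e : Term arity m) ρ {v b} → Runs (den e ρ ret) v b →
        ∃[ t ] t ≤ termSize e + K * b × ρ ⊢ e ⇓ v cost t
  run e ρ r with den-sound e ρ ret r
  ... | evaluates {used = x} p p≤ ret e₁ =
    _ , subst (λ b → _ ≤ termSize e + K * b) (trans (sym (+-identityʳ x)) e₁) p≤ , p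

  proc : ∀ {f vs v s} → Runs (den (body f) vs ret) v s → f $ vs ⇓ v ⟨ suc s ⟩
  proc {f} {vs} {s = s} r with run (body f) vs r
  ... | t , t≤ , p =
    runs (≤-trans t≤ (≤-trans (+-monoˡ-≤ _ (bodies≤K f)) (≤-reflexive (sym (*-suc K s))))) p

  relax : ∀ {f vs v s t} → s ≤ t → f $ vs ⇓ v ⟨ s ⟩ → f $ vs ⇓ v ⟨ t ⟩
  relax s≤t (runs c≤ p) = runs (≤-trans c≤ (*-monoʳ-≤ K s≤t)) p

  outputs : ∀ {f vs u v s} → u ≡ v → f $ vs ⇓ u ⟨ s ⟩ → f $ vs ⇓ v ⟨ s ⟩
  outputs refl p = p

-- The counting program

arities : Vec ℕ 27
arities = 2 ∷ 1 ∷ 2 ∷ 2 ∷ 2 ∷ 1 ∷ 2 ∷ 2 ∷ 2 ∷ 1 ∷ 3 ∷ 3 ∷ 3 ∷ 2 ∷ 3 ∷ 4 ∷ 3 ∷ 4 ∷ 4 ∷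
          1 ∷ 1 ∷ 2 ∷ 2 ∷ 2 ∷ 2 ∷ 2 ∷ 1 ∷ []

EQ SUC ADD MUL APPEND UNARY UNION MEMBER REMOVE SINGLE RELABELSET RELABELKEY BAD COMBINE
  INSERT ROW PROD RELABEL JOIN ZEROS CONSALL UNITS EVAL NEAR NEARALL EQUITABLE TOTAL : Fin 27
EQ         = # 0
SUC        = # 1
ADD        = # 2
MUL        = # 3
APPEND     = # 4
UNARY      = # 5
UNION      = # 6
MEMBER     = # 7
REMOVE     = # 8
SINGLE     = # 9
RELABELSET = # 10
RELABELKEY = # 11
BAD        = # 12
COMBINE    = # 13
INSERT     = # 14
ROW        = # 15
PROD       = # 16
RELABEL    = # 17
JOIN       = # 18
ZEROS      = # 19
CONSALL    = # 20
UNITS      = # 21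
EVAL       = # 22
NEAR       = # 23
NEARALL    = # 24
EQUITABLE  = # 25
TOTAL      = # 26

private
  Tm : ℕ → Set
  Tm = Term (lookup arities)

  v : ∀ i {m} {i<m : True (i <? m)} → Tm m
  v i {i<m = i<m} = var (#_ i {m<n = i<m})

  tt : ∀ {m} → Tm m
  tt = cons nil nil

-- Where a `case` only takes apart a pair, its first branch is never reached on encoded data, and
-- the `nil` there is arbitrary.
bodies : VecAll Tm arities
bodies =
  -- EQ s t
    case (v 0) (case (v 1) tt nil)
      (case (v 3) nil
        (case (call EQ (v 2 ∷ v 0 ∷ [])) nil
          (call EQ (v 5 ∷ v 3 ∷ []))))
  -- SUC x
  ∷ case (v 0) tt
      (case (v 0) (cons tt (v 1))
        (cons nil (call SUC (v 3 ∷ []))))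
  -- ADD x y
  ∷ case (v 0) (v 1)
      (case (v 3) (v 2)
        (case (v 2)
          (case (v 0)
            (call SUC (cons nil (call ADD (v 3 ∷ v 1 ∷ [])) ∷ []))
            (call SUC (cons tt (call ADD (v 5 ∷ v 3 ∷ [])) ∷ [])))
          (case (v 2)
            (call SUC (cons tt (call ADD (v 5 ∷ v 3 ∷ [])) ∷ []))
            (cons tt (call SUC (call ADD (v 7 ∷ v 5 ∷ []) ∷ []))))))
  -- MUL x y
  ∷ case (v 0) nil
      (bind (call MUL (v 1 ∷ v 3 ∷ []))
        (case (v 1)
          (call ADD (v 4 ∷ call ADD (v 0 ∷ v 0 ∷ []) ∷ []))
          (bind (call ADD (v 6 ∷ v 2 ∷ []))
            (call ADD (v 0 ∷ v 0 ∷ [])))))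
  -- APPEND x y
  ∷ case (v 0) (v 1)
      (cons nil (call APPEND (v 1 ∷ v 3 ∷ [])))
  -- UNARY x
  ∷ case (v 0) nil
      (bind (call UNARY (v 1 ∷ []))
        (case (v 1)
          (cons nil (call APPEND (v 0 ∷ call APPEND (v 0 ∷ nil ∷ []) ∷ [])))
          (call APPEND (cons nil (v 2) ∷ call APPEND (cons nil (v 2) ∷ nil ∷ []) ∷ []))))
  -- UNION S T
  ∷ case (v 0) (v 1)
      (case (v 3) (v 2)
        (cons (case (v 2) (v 0) tt) (call UNION (v 3 ∷ v 1 ∷ []))))
  -- MEMBER i S
  ∷ case (v 1) nil
      (case (v 2) (v 0)
        (call MEMBER (v 1 ∷ v 3 ∷ [])))
  -- REMOVE i S
  ∷ case (v 1) nil
      (case (v 2) (cons nil (v 1))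
        (cons (v 2) (call REMOVE (v 1 ∷ v 3 ∷ []))))
  -- SINGLE i
  ∷ case (v 0) (cons tt nil)
      (cons nil (call SINGLE (v 1 ∷ [])))
  -- RELABELSET i j S
  ∷ case (call MEMBER (v 0 ∷ v 2 ∷ [])) (v 2)
      (call UNION (call REMOVE (v 2 ∷ v 4 ∷ []) ∷ call SINGLE (v 3 ∷ []) ∷ []))
  -- RELABELKEY i j s
  ∷ case (v 2) nil
      (case (v 0) nil
        (cons (cons (v 0) (call RELABELSET (v 4 ∷ v 5 ∷ v 1 ∷ [])))
          (call RELABELKEY (v 4 ∷ v 5 ∷ v 3 ∷ []))))
  -- BAD i j s
  ∷ case (v 2) nil
      (case (v 0) nil
        (case (call MEMBER (v 4 ∷ v 1 ∷ []))
          (call BAD (v 4 ∷ v 5 ∷ v 3 ∷ []))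
          (case (call MEMBER (v 7 ∷ v 3 ∷ []))
            (call BAD (v 6 ∷ v 7 ∷ v 5 ∷ []))
            tt)))
  -- COMBINE s t
  ∷ case (v 0) nil
      (case (v 3) nil
        (case (v 2) nil
          (case (v 2) nil
            (cons (cons (call ADD (v 2 ∷ v 0 ∷ [])) (call UNION (v 3 ∷ v 1 ∷ [])))
              (call COMBINE (v 7 ∷ v 5 ∷ []))))))
  -- INSERT s c T
  ∷ case (v 2) (cons (cons (v 0) (v 1)) nil)
      (case (v 0) nil
        (case (call EQ (v 4 ∷ v 0 ∷ []))
          (cons (v 2) (call INSERT (v 4 ∷ v 5 ∷ v 3 ∷ [])))
          (cons (cons (v 2) (call ADD (v 7 ∷ v 3 ∷ []))) (v 5))))
  -- ROW s c T acc
  ∷ case (v 2) (v 3)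
      (case (v 0) nil
        (call ROW (v 4 ∷ v 5 ∷ v 3 ∷
          call INSERT (call COMBINE (v 4 ∷ v 0 ∷ []) ∷ call MUL (v 5 ∷ v 1 ∷ []) ∷ v 7 ∷ []) ∷ [])))
  -- PROD T T′ acc
  ∷ case (v 0) (v 2)
      (case (v 0) nil
        (call PROD (v 3 ∷ v 5 ∷ call ROW (v 0 ∷ v 1 ∷ v 5 ∷ v 6 ∷ []) ∷ [])))
  -- RELABEL i j T acc
  ∷ case (v 2) (v 3)
      (case (v 0) nil
        (call RELABEL (v 4 ∷ v 5 ∷ v 3 ∷
          call INSERT (call RELABELKEY (v 4 ∷ v 5 ∷ v 0 ∷ []) ∷ v 1 ∷ v 7 ∷ []) ∷ [])))
  -- JOIN i j T acc
  ∷ case (v 2) (v 3)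
      (case (v 0) nil
        (case (call BAD (v 4 ∷ v 5 ∷ v 0 ∷ []))
          (call JOIN (v 4 ∷ v 5 ∷ v 3 ∷ call INSERT (v 0 ∷ v 1 ∷ v 7 ∷ []) ∷ []))
          (call JOIN (v 6 ∷ v 7 ∷ v 5 ∷ v 9 ∷ []))))
  -- ZEROS k
  ∷ case (v 0) nil
      (cons tt (call ZEROS (v 1 ∷ [])))
  -- CONSALL T
  ∷ case (v 0) nil
      (case (v 0) nil
        (cons (cons (cons tt (v 0)) (v 1)) (call CONSALL (v 3 ∷ []))))
  -- UNITS k x
  ∷ case (v 0) nil
      (cons (cons (cons (v 3) (call ZEROS (v 1 ∷ []))) tt)
        (call CONSALL (call UNITS (v 1 ∷ v 3 ∷ []) ∷ [])))
  -- EVAL e k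
  ∷ case (v 0) nil
      (case (v 0)
        (call UNITS (v 3 ∷ cons tt (call SINGLE (call UNARY (v 1 ∷ []) ∷ [])) ∷ []))
        -- In bijective binary the tags 1, 2 and 3 have the digits 1, 2 and 1 1: the first digit
        -- singles out `relabel`, and the remaining ones tell `_⊕_` from `join`.
        (case (v 0)
          (case (v 1)
            (case (v 3) nil
              (call PROD (call EVAL (v 0 ∷ v 7 ∷ []) ∷ call EVAL (v 1 ∷ v 7 ∷ []) ∷ nil ∷ [])))
            (case (v 5) nil (case (v 1) nil
              (call JOIN (call UNARY (v 2 ∷ []) ∷ call UNARY (v 0 ∷ []) ∷
                          call EVAL (v 1 ∷ v 11 ∷ []) ∷ nil ∷ [])))))
          (case (v 5) nil (case (v 1) nil
            (call RELABEL (call UNARY (v 2 ∷ []) ∷ call UNARY (v 0 ∷ []) ∷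
                           call EVAL (v 1 ∷ v 11 ∷ []) ∷ nil ∷ []))))))
  -- NEAR x y
  ∷ case (call EQ (v 0 ∷ v 1 ∷ []))
      (case (call EQ (call SUC (v 0 ∷ []) ∷ v 1 ∷ []))
        (call EQ (v 0 ∷ call SUC (v 1 ∷ []) ∷ []))
        tt)
      tt
  -- NEARALL x s
  ∷ case (v 1) tt
      (case (v 0) nil
        (case (call NEAR (v 4 ∷ v 0 ∷ [])) nil
          (call NEARALL (v 6 ∷ v 5 ∷ []))))
  -- EQUITABLE t s
  ∷ case (v 0) tt
      (case (v 0) nil
        (case (call NEARALL (v 0 ∷ v 5 ∷ [])) nil
          (call EQUITABLE (v 5 ∷ v 7 ∷ []))))
  -- TOTAL T
  ∷ case (v 0) nil
      (case (v 0) nil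
        (case (call EQUITABLE (v 0 ∷ v 0 ∷ []))
          (call TOTAL (v 3 ∷ []))
          (call ADD (v 3 ∷ call TOTAL (v 5 ∷ []) ∷ []))))
  ∷ []

program : Program
program .Program.procedures = 27
program .Program.arity      = lookup arities
program .Program.body       = lookup⁺ bodies
program .Program.main       =
  case (v 0) nil (case (v 1) nil (case (v 1) nil
    (call TOTAL (call EVAL (v 1 ∷ call UNARY (v 4 ∷ []) ∷ []) ∷ []))))

bodies≤100 : ∀ f → termSize (Program.body program f) ≤ 100
bodies≤100 = from-yes (all? λ f → termSize (Program.body program f) ≤? 100)

open CallCounting program 100 bodies≤100

-- Signatures and tables

-- The size of a color class and the labels in it, as a bit list possibly ending in zeros.
Entry : Set
Entry = ℕ × List Bool

Key : ℕ → Set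
Key k = Vec Entry k

Table : ℕ → Set
Table k = List (Key k × ℕ)

_≟ᴷ_ : ∀ {k} → DecidableEquality (Key k)
_≟ᴷ_ = Vec.≡-dec (×-≡-dec _≟_ (List.≡-dec Bool._≟_))

infixr 6 _∪_

_∪_ : List Bool → List Bool → List Bool
[]      ∪ T       = T
(a ∷ S) ∪ []      = a ∷ S
(a ∷ S) ∪ (b ∷ T) = (a ∨ b) ∷ (S ∪ T)

member : ℕ → List Bool → Bool
member _       []      = false
member zero    (b ∷ _) = b
member (suc i) (_ ∷ S) = member i S

remove : ℕ → List Bool → List Bool
remove _       []      = []
remove zero    (_ ∷ S) = false ∷ S
remove (suc i) (b ∷ S) = b ∷ remove i S

single : ℕ → List Bool
single zero    = true ∷ []
single (suc i) = false ∷ single i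

relabelSet : ℕ → ℕ → List Bool → List Bool
relabelSet i j S = if member i S then remove i S ∪ single j else S

relabelEntry : ℕ → ℕ → Entry → Entry
relabelEntry i j (x , S) = x , relabelSet i j S

bad : ∀ {k} → ℕ → ℕ → Key k → Bool
bad i j []            = false
bad i j ((_ , S) ∷ s) = (member i S ∧ member j S) ∨ bad i j s

combineEntry : Entry → Entry → Entry
combineEntry (x , S) (y , T) = x + y , S ∪ T

combine : ∀ {k} → Key k → Key k → Key k
combine = Vec.zipWith combineEntry

zeros : ∀ k → Key k
zeros k = Vec.replicate k (0 , [])

insert : ∀ {k} → Key k → ℕ → Table k → Table k
insert s c []             = (s , c) ∷ []
insert s c ((t , d) ∷ T) =
  if does (s ≟ᴷ t) then (t , c + d) ∷ T else (t , d) ∷ insert s c T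

insertAll : ∀ {k} → Table k → Table k → Table k
insertAll []            acc = acc
insertAll ((s , c) ∷ T) acc = insertAll T (insert s c acc)

-- `rowTable`, `relabelTable` and `joinTable` are plain lists of rows whose keys may repeat. The
-- program never builds them, as it inserts each row at once; separating them from `insertAll` lets
-- their weights be computed row by row.
rowTable : ∀ {k} → Key k → ℕ → Table k → Table k
rowTable s c []            = []
rowTable s c ((t , d) ∷ T) = (combine s t , c * d) ∷ rowTable s c T

product : ∀ {k} → Table k → Table k → Table k → Table k
product []            T acc = acc
product ((s , c) ∷ S) T acc = product S T (insertAll (rowTable s c T) acc)

relabelTable : ∀ {k} → ℕ → ℕ → Table k → Table k
relabelTable i j []            = []
relabelTable i j ((s , c) ∷ T) = (Vec.map (relabelEntry i j) s , c) ∷ relabelTable i j T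

joinTable : ∀ {k} → ℕ → ℕ → Table k → Table k
joinTable i j []            = []
joinTable i j ((s , c) ∷ T) =
  if bad i j s then joinTable i j T else (s , c) ∷ joinTable i j T

consAll : ∀ {k} → Table k → Table (suc k)
consAll []            = []
consAll ((s , c) ∷ T) = ((0 , []) ∷ s , c) ∷ consAll T

units : ∀ k → Entry → Table k
units zero    x = []
units (suc k) x = (x ∷ zeros k , 1) ∷ consAll (units k x)

-- The condition that two sizes differ by at most 1, in a form that needs only successor and
-- equality.
near : ℕ → ℕ → Bool
near x y = does (x ≟ y) ∨ (does (suc x ≟ y) ∨ does (x ≟ suc y))

nearAll : ∀ {k} → ℕ → Key k → Bool
nearAll x []            = true
nearAll x ((y , _) ∷ s) = near x y ∧ nearAll x s

-- Two arguments, because the recursion consumes one copy of the key while every size in it is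
-- compared with the whole of the other copy.
equitable : ∀ {k l} → Key l → Key k → Bool
equitable []            s = true
equitable ((x , _) ∷ t) s = nearAll x s ∧ equitable t s

total : ∀ {k} → Table k → ℕ
total []            = 0
total ((s , c) ∷ T) = if equitable s s then c + total T else total T

-- Encodings

unary : ℕ → Tree
unary zero    = nil
unary (suc n) = nil ∙ unary n

encodeSet : List Bool → Tree
encodeSet = encodeList encodeBool

encodeEntry : Entry → Tree
encodeEntry (x , S) = ⌜ x ⌝ ∙ encodeSet S

encodeKey : ∀ {k} → Key k → Tree
encodeKey []      = nil
encodeKey (x ∷ s) = encodeEntry x ∙ encodeKey s

encodeRow : ∀ {k} → Key k × ℕ → Tree
encodeRow (s , c) = encodeKey s ∙ ⌜ c ⌝

encodeTable : ∀ {k} → Table k → Tree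
encodeTable = encodeList encodeRow

∙-injective : ∀ {a b c d} → a ∙ b ≡ c ∙ d → a ≡ c × b ≡ d
∙-injective refl = refl , refl

⌜⌝ᵇ-injective : ∀ {x y} → ⌜ x ⌝ᵇ ≡ ⌜ y ⌝ᵇ → x ≡ y
⌜⌝ᵇ-injective {ᵇ.zero}  {ᵇ.zero}  _ = refl
⌜⌝ᵇ-injective {2[1+ x ]} {2[1+ y ]} p = cong 2[1+_] (⌜⌝ᵇ-injective (proj₂ (∙-injective p)))
⌜⌝ᵇ-injective {1+[2 x ]} {1+[2 y ]} p = cong 1+[2_] (⌜⌝ᵇ-injective (proj₂ (∙-injective p)))

⌜⌝-injective : ∀ {x y} → ⌜ x ⌝ ≡ ⌜ y ⌝ → x ≡ y
⌜⌝-injective = ᵇ.fromℕ-injective ∘ ⌜⌝ᵇ-injective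

encodeSet-injective : ∀ {S T} → encodeSet S ≡ encodeSet T → S ≡ T
encodeSet-injective {[]}        {[]}        _ = refl
encodeSet-injective {false ∷ S} {false ∷ T} p =
  cong (false ∷_) (encodeSet-injective (proj₂ (∙-injective p)))
encodeSet-injective {true ∷ S}  {true ∷ T}  p =
  cong (true ∷_) (encodeSet-injective (proj₂ (∙-injective p)))

encodeKey-injective : ∀ {k} {s t : Key k} → encodeKey s ≡ encodeKey t → s ≡ t
encodeKey-injective {s = []}    {[]}    _ = refl
encodeKey-injective {s = x ∷ s} {y ∷ t} p with ∙-injective p
... | q , r with ∙-injective q
... | q₁ , q₂ = cong₂ _∷_ (cong₂ _,_ (⌜⌝-injective q₁) (encodeSet-injective q₂))
                          (encodeKey-injective r)

eqᵀ : Tree → Tree → Bool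
eqᵀ nil     nil       = true
eqᵀ nil     (_ ∙ _)   = false
eqᵀ (_ ∙ _) nil       = false
eqᵀ (l ∙ r) (l′ ∙ r′) = eqᵀ l l′ ∧ eqᵀ r r′

eqᵀ-refl : ∀ s → eqᵀ s s ≡ true
eqᵀ-refl nil     = refl
eqᵀ-refl (l ∙ r) = cong₂ _∧_ (eqᵀ-refl l) (eqᵀ-refl r)

eqᵀ-sound : ∀ s t → eqᵀ s t ≡ true → s ≡ t
eqᵀ-sound nil     nil       _ = refl
eqᵀ-sound (l ∙ r) (l′ ∙ r′) p with eqᵀ l l′ in q
... | true = cong₂ _∙_ (eqᵀ-sound l l′ q) (eqᵀ-sound r r′ p)

-- The program compares codes, so an injective encoding turns its answer into equality of the
-- encoded objects.
eqᵀ-does : ∀ {A : Set} (encode : A → Tree) →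
           (∀ {a b} → encode a ≡ encode b → a ≡ b) →
           ∀ {a b} (a≟b : Dec (a ≡ b)) → eqᵀ (encode a) (encode b) ≡ does a≟b
eqᵀ-does encode inj {a} (yes refl) = eqᵀ-refl (encode a)
eqᵀ-does encode inj {a} {b} (no a≢b) with eqᵀ (encode a) (encode b) in q
... | true  = contradiction (inj (eqᵀ-sound _ _ q)) a≢b
... | false = refl

fromℕ-suc : ∀ n → fromℕ (suc n) ≡ ᵇ.suc (fromℕ n)
fromℕ-suc n = trans (ᵇ.fromℕ≡fromℕ' (suc n)) (cong ᵇ.suc (sym (ᵇ.fromℕ≡fromℕ' n)))

-- Calls made by arithmetic and by operations on label sets

eq-runs : ∀ s t → EQ $ s ∷ t ∷ [] ⇓ encodeBool (eqᵀ s t) ⟨ treeSize s ⟩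
eq-runs nil     nil       = proc ret
eq-runs nil     (_ ∙ _)   = proc ret
eq-runs (l ∙ r) nil       = relax (s≤s z≤n) (proc ret)
eq-runs (l ∙ r) (l′ ∙ r′) = go _ (eq-runs l l′) (eq-runs r r′)
  where
  -- The outcome of the first comparison is replaced by a variable together with the run that
  -- outputs it. Matching on `b` then reduces the continuation and the expected output at once. The
  -- local functions `step` in later proofs about calls serve the same purpose.
  go : ∀ b {c m n} → EQ $ l ∷ l′ ∷ [] ⇓ encodeBool b ⟨ m ⟩ →
       EQ $ r ∷ r′ ∷ [] ⇓ encodeBool c ⟨ n ⟩ →
       EQ $ (l ∙ r) ∷ (l′ ∙ r′) ∷ [] ⇓ encodeBool (b ∧ c) ⟨ suc (m + n) ⟩
  go true  p q = proc (p ⨾ last q refl)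
  go false p q = relax (s≤s (+-monoʳ-≤ _ z≤n)) (proc (p ⨾ ret))

sucᵇ-runs : ∀ x → SUC $ ⌜ x ⌝ᵇ ∷ [] ⇓ ⌜ ᵇ.suc x ⌝ᵇ ⟨ suc (ᵇ.size x) ⟩
sucᵇ-runs ᵇ.zero   = proc ret
sucᵇ-runs 2[1+ x ] = proc (last (sucᵇ-runs x) refl)
sucᵇ-runs 1+[2 x ] = relax (s≤s z≤n) (proc ret)

suc-runs : ∀ n → SUC $ ⌜ n ⌝ ∷ [] ⇓ ⌜ suc n ⌝ ⟨ suc (ᵇ.size (fromℕ n)) ⟩
suc-runs n = outputs (cong ⌜_⌝ᵇ (sym (fromℕ-suc n))) (sucᵇ-runs (fromℕ n))

size-suc : ∀ x → ᵇ.size (ᵇ.suc x) ≤ suc (ᵇ.size x)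
size-suc ᵇ.zero   = ≤-refl
size-suc 2[1+ x ] = s≤s (size-suc x)
size-suc 1+[2 x ] = n≤1+n _

size-+ : ∀ x y → ᵇ.size (x ᵇ.+ y) ≤ ᵇ.size x + ᵇ.size y
size-+ ᵇ.zero   y        = ≤-refl
size-+ 2[1+ x ] ᵇ.zero   = ≤-reflexive (sym (+-identityʳ _))
size-+ 1+[2 x ] ᵇ.zero   = ≤-reflexive (sym (+-identityʳ _))
size-+ 2[1+ x ] 2[1+ y ] = s≤s (≤-trans (size-suc (x ᵇ.+ y))
  (≤-trans (s≤s (size-+ x y)) (≤-reflexive (sym (+-suc _ _)))))
size-+ 2[1+ x ] 1+[2 y ] = s≤s (≤-trans (size-suc (x ᵇ.+ y))
  (≤-trans (s≤s (size-+ x y)) (≤-reflexive (sym (+-suc _ _)))))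
size-+ 1+[2 x ] 2[1+ y ] = s≤s (≤-trans (size-suc (x ᵇ.+ y))
  (≤-trans (s≤s (size-+ x y)) (≤-reflexive (sym (+-suc _ _)))))
size-+ 1+[2 x ] 1+[2 y ] = s≤s (≤-trans (size-+ x y)
  (+-monoʳ-≤ (ᵇ.size x) (n≤1+n _)))

-- Quadratic, because `ADD` handles a carry by calling `SUC` on the recursive result, and at each
-- digit the carry may run through the whole sum.
addCalls : ℕ → ℕ
addCalls n = suc n * suc n

addᵇ-runs : ∀ x y → ADD $ ⌜ x ⌝ᵇ ∷ ⌜ y ⌝ᵇ ∷ [] ⇓ ⌜ x ᵇ.+ y ⌝ᵇ ⟨ addCalls (ᵇ.size x + ᵇ.size y) ⟩
addᵇ-runs x y = go x y
  where
  step : ∀ a b {c} → c ≤ a + b → suc (addCalls (a + b) + suc (suc c)) ≤ addCalls (suc a + suc b)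
  step a b {c} c≤ = ≤-trans (s≤s (+-monoʳ-≤ (addCalls (a + b)) (s≤s (s≤s c≤))))
    (≤-trans (m≤m+n _ (5 + (a + b) * 3)) (≤-reflexive (identity a b)))
    where
    identity : ∀ a b → suc (suc (a + b) * suc (a + b) + suc (suc (a + b))) + (5 + (a + b) * 3)
                     ≡ suc (suc a + suc b) * suc (suc a + suc b)
    identity = solve-∀
  go : ∀ x y → ADD $ ⌜ x ⌝ᵇ ∷ ⌜ y ⌝ᵇ ∷ [] ⇓ ⌜ x ᵇ.+ y ⌝ᵇ ⟨ addCalls (ᵇ.size x + ᵇ.size y) ⟩
  go ᵇ.zero   y        = relax (s≤s z≤n) (proc ret)
  go 2[1+ x ] ᵇ.zero   = relax (s≤s z≤n) (proc ret)
  go 1+[2 x ] ᵇ.zero   = relax (s≤s z≤n) (proc ret)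
  go 2[1+ x ] 2[1+ y ] = relax (step (ᵇ.size x) (ᵇ.size y) (size-+ x y))
    (proc (go x y ⨾ last (relax (n≤1+n _) (sucᵇ-runs (x ᵇ.+ y))) refl))
  go 2[1+ x ] 1+[2 y ] = relax (step (ᵇ.size x) (ᵇ.size y) (size-+ x y))
    (proc (go x y ⨾ last (sucᵇ-runs 2[1+ x ᵇ.+ y ]) refl))
  go 1+[2 x ] 2[1+ y ] = relax (step (ᵇ.size x) (ᵇ.size y) (size-+ x y))
    (proc (go x y ⨾ last (sucᵇ-runs 2[1+ x ᵇ.+ y ]) refl))
  go 1+[2 x ] 1+[2 y ] = relax (step (ᵇ.size x) (ᵇ.size y) (size-+ x y))
    (proc (go x y ⨾ last (sucᵇ-runs 1+[2 x ᵇ.+ y ]) refl))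

append-runs : ∀ m n → APPEND $ unary m ∷ unary n ∷ [] ⇓ unary (m + n) ⟨ suc m ⟩
append-runs zero    n = proc ret
append-runs (suc m) n = proc (last (append-runs m n) refl)

-- Each digit appends lists about as long as the value read so far. These lengths double from one
-- digit to the next, so the calls add up to a multiple of the final value.
unary-runs : ∀ x → UNARY $ ⌜ x ⌝ᵇ ∷ [] ⇓ unary (ᵇ.toℕ x) ⟨ suc (3 * ᵇ.toℕ x) ⟩
unary-runs ᵇ.zero   = proc ret
unary-runs 2[1+ x ] = relax (≤-trans (m≤m+n _ (1 + n)) (≤-reflexive (identity n)))
  (proc (unary-runs x ⨾ append-runs (suc n) 0 ⨾ last (append-runs (suc n) (suc n + 0)) refl))
  where
  n = ᵇ.toℕ x
  identity : ∀ n → suc (suc (3 * n) + (suc (suc n) + suc (suc n))) + (1 + n)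
                 ≡ suc (3 * (2 * suc n))
  identity = solve-∀
unary-runs 1+[2 x ] = relax (≤-trans (m≤m+n _ n) (≤-reflexive (identity n)))
  (proc (unary-runs x ⨾ append-runs n 0 ⨾ last (append-runs n (n + 0)) refl))
  where
  n = ᵇ.toℕ x
  identity : ∀ n → suc (suc (3 * n) + (suc n + suc n)) + n ≡ suc (3 * suc (2 * n))
  identity = solve-∀

union-runs : ∀ S T → UNION $ encodeSet S ∷ encodeSet T ∷ [] ⇓ encodeSet (S ∪ T) ⟨ suc (length S) ⟩
union-runs []          T       = proc ret
union-runs (a ∷ S)     []      = relax (s≤s z≤n) (proc ret)
union-runs (false ∷ S) (b ∷ T) = proc (last (union-runs S T) refl)
union-runs (true ∷ S)  (b ∷ T) = proc (last (union-runs S T) refl)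

member-runs : ∀ i S → MEMBER $ unary i ∷ encodeSet S ∷ [] ⇓ encodeBool (member i S) ⟨ suc (length S) ⟩
member-runs i       []      = proc ret
member-runs zero    (b ∷ S) = relax (s≤s z≤n) (proc ret)
member-runs (suc i) (b ∷ S) = proc (last (member-runs i S) refl)

remove-runs : ∀ i S → REMOVE $ unary i ∷ encodeSet S ∷ [] ⇓ encodeSet (remove i S) ⟨ suc (length S) ⟩
remove-runs i       []      = proc ret
remove-runs zero    (b ∷ S) = relax (s≤s z≤n) (proc ret)
remove-runs (suc i) (b ∷ S) = proc (last (remove-runs i S) refl)

single-runs : ∀ i → SINGLE $ unary i ∷ [] ⇓ encodeSet (single i) ⟨ suc i ⟩
single-runs zero    = proc ret
single-runs (suc i) = proc (last (single-runs i) refl)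

zeros-runs : ∀ k → ZEROS $ unary k ∷ [] ⇓ encodeKey (zeros k) ⟨ suc k ⟩
zeros-runs zero    = proc ret
zeros-runs (suc k) = proc (last (zeros-runs k) refl)

consAll-runs : ∀ {k} (T : Table k) →
               CONSALL $ encodeTable T ∷ [] ⇓ encodeTable (consAll T) ⟨ suc (length T) ⟩
consAll-runs []            = proc ret
consAll-runs ((s , c) ∷ T) = proc (last (consAll-runs T) refl)

-- In bijective binary every digit is at least 1, so a numeral with `L` digits is worth at least
-- `1 + 2 + ... + 2 ^ (L - 1)`.
2^size≤1+toℕ : ∀ x → 2 ^ ᵇ.size x ≤ suc (ᵇ.toℕ x)
2^size≤1+toℕ ᵇ.zero   = ≤-refl
2^size≤1+toℕ 2[1+ x ] = ≤-trans (*-monoʳ-≤ 2 (2^size≤1+toℕ x)) (n≤1+n _)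
2^size≤1+toℕ 1+[2 x ] = ≤-trans (*-monoʳ-≤ 2 (2^size≤1+toℕ x))
  (≤-reflexive (*-suc 2 (ᵇ.toℕ x)))

size-fromℕ : ∀ {L} x → x < 2 ^ L → ᵇ.size (fromℕ x) ≤ L
size-fromℕ {L} x x<2^L = ≮⇒≥ λ L<s → <⇒≱ (^-monoʳ-< 2 ≤-refl L<s)
  (≤-trans (2^size≤1+toℕ (fromℕ x)) (subst (λ y → suc y ≤ 2 ^ L) (sym (ᵇ.toℕ-fromℕ x)) x<2^L))

-- The factor 4 is the cost of a digit 2: three nodes for `nil ∙ nil` and one for the pair that
-- holds it.
treeSize-⌜⌝ᵇ : ∀ x → treeSize ⌜ x ⌝ᵇ ≤ suc (4 * ᵇ.size x)
treeSize-⌜⌝ᵇ ᵇ.zero   = ≤-refl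
treeSize-⌜⌝ᵇ 2[1+ x ] = s≤s (≤-trans (+-monoʳ-≤ 3 (treeSize-⌜⌝ᵇ x))
  (≤-reflexive (sym (*-suc 4 (ᵇ.size x)))))
treeSize-⌜⌝ᵇ 1+[2 x ] = s≤s (≤-trans (s≤s (treeSize-⌜⌝ᵇ x))
  (≤-trans (m≤n+m _ 2) (≤-reflexive (sym (*-suc 4 (ᵇ.size x))))))

treeSize-encodeSet : ∀ S → treeSize (encodeSet S) ≤ suc (4 * length S)
treeSize-encodeSet []          = ≤-refl
treeSize-encodeSet (true ∷ S)  = s≤s (≤-trans (+-monoʳ-≤ 3 (treeSize-encodeSet S))
  (≤-reflexive (sym (*-suc 4 (length S)))))
treeSize-encodeSet (false ∷ S) = s≤s (≤-trans (s≤s (treeSize-encodeSet S))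
  (≤-trans (m≤n+m _ 2) (≤-reflexive (sym (*-suc 4 (length S))))))

length-∪ : ∀ {w} S T → length S ≤ w → length T ≤ w → length (S ∪ T) ≤ w
length-∪ []      T       _       q       = q
length-∪ (_ ∷ _) []      p       _       = p
length-∪ (_ ∷ S) (_ ∷ T) (s≤s p) (s≤s q) = s≤s (length-∪ S T p q)

length-remove : ∀ i S → length (remove i S) ≡ length S
length-remove i       []      = refl
length-remove zero    (_ ∷ S) = refl
length-remove (suc i) (_ ∷ S) = cong suc (length-remove i S)

length-single : ∀ i → length (single i) ≡ suc i
length-single zero    = refl
length-single (suc i) = cong suc (length-single i)

length-consAll : ∀ {k} (T : Table k) → length (consAll T) ≡ length T
length-consAll []            = refl
length-consAll ((s , c) ∷ T) = cong suc (length-consAll T)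

length-units : ∀ k x → length (units k x) ≡ k
length-units zero    x = refl
length-units (suc k) x = cong suc (trans (length-consAll (units k x)) (length-units k x))

-- The constants bound the numbers of calls made when every quantity they depend on
-- (table length, number of digits, number of colors, label set length) is at most M.
module Bounded (M : ℕ) where

  addC eqC keyC mulC combineC insertC rowC prodC relabelSetC relabelKeyC relabelC badC joinC
    unaryC unitsC nearC equitableC totalC : ℕ
  addC        = addCalls (M + M)
  eqC         = suc (4 * M)
  keyC        = suc (M * suc (suc (eqC + eqC)))
  mulC        = suc M * suc (addC + addC)
  combineC    = suc M * suc (addC + suc M)
  insertC     = suc M * suc (keyC + addC)
  rowC        = suc M * suc (combineC + (mulC + insertC))
  prodC       = suc M * suc rowC
  relabelSetC = suc (suc M + (suc M + (suc M + suc M)))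
  relabelKeyC = suc M * suc relabelSetC
  relabelC    = suc M * suc (relabelKeyC + insertC)
  badC        = suc M * suc (suc M + suc M)
  joinC       = suc M * suc (badC + insertC)
  unaryC      = suc (3 * M)
  unitsC      = suc M * suc (suc M + suc M)
  nearC       = suc (eqC + (suc M + (eqC + (suc M + eqC))))
  equitableC  = suc M * suc (suc M * suc nearC)
  totalC      = suc M * suc (equitableC + addC)

  SmallEntry : Entry → Set
  SmallEntry (x , S) = suc x < 2 ^ M × length S ≤ M

  Small : ∀ {k} → Key k → Set
  Small = VecAll SmallEntry

  add-runs : ∀ x y → x < 2 ^ M → y < 2 ^ M → ADD $ ⌜ x ⌝ ∷ ⌜ y ⌝ ∷ [] ⇓ ⌜ x + y ⌝ ⟨ addC ⟩
  add-runs x y x< y< =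
    relax (*-mono-≤ (s≤s size≤) (s≤s size≤))
      (outputs (cong ⌜_⌝ᵇ (sym (ᵇ.fromℕ-homo-+ x y))) (addᵇ-runs (fromℕ x) (fromℕ y)))
    where size≤ = +-mono-≤ (size-fromℕ {M} x x<) (size-fromℕ {M} y y<)

  -- With `z` the product of `y` and the numeral without its first digit, the result is
  -- `y + (z + z)` or `(y + z) + (y + z)`. Both digits are positive, so every intermediate sum is at
  -- most the final product, and bounding that one is enough.
  mulᵇ-runs : ∀ x y → ᵇ.toℕ x * y < 2 ^ M →
              MUL $ ⌜ x ⌝ᵇ ∷ ⌜ y ⌝ ∷ [] ⇓ ⌜ ᵇ.toℕ x * y ⌝ ⟨ suc (ᵇ.size x) * suc (addC + addC) ⟩
  mulᵇ-runs ᵇ.zero   y _ = relax (s≤s z≤n) (proc ret)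
  mulᵇ-runs 2[1+ x ] y p =
    relax (≤-reflexive (cong suc (+-comm (suc (ᵇ.size x) * suc (addC + addC)) (addC + addC))))
      (outputs (cong ⌜_⌝ (sym eq))
        (proc (mulᵇ-runs x y z< ⨾ add-runs y (n * y) y< z< ⨾ last (add-runs u u u< u<) refl)))
    where
    n = ᵇ.toℕ x
    u = y + n * y
    eq : 2 * suc n * y ≡ u + u
    eq = trans (*-assoc 2 (suc n) y) (cong (u +_) (+-identityʳ u))
    u< : u < 2 ^ M
    u< = ≤-<-trans (≤-trans (m≤m+n u u) (≤-reflexive (sym eq))) p
    y< = ≤-<-trans (m≤m+n y (n * y)) u<
    z< = ≤-<-trans (m≤n+m (n * y) y) u<
  mulᵇ-runs 1+[2 x ] y p =
    relax (≤-reflexive (cong suc (+-comm (suc (ᵇ.size x) * suc (addC + addC)) (addC + addC))))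
      (outputs (cong ⌜_⌝ (sym eq))
        (proc (mulᵇ-runs x y z< ⨾ add-runs z z z< z< ⨾ last (add-runs y (z + z) y< 2z<) refl)))
    where
    n = ᵇ.toℕ x
    z = n * y
    eq : suc (2 * n) * y ≡ y + (z + z)
    eq = cong (y +_) (trans (*-assoc 2 n y) (cong (z +_) (+-identityʳ z)))
    y< = ≤-<-trans (≤-trans (m≤m+n y (z + z)) (≤-reflexive (sym eq))) p
    2z< = ≤-<-trans (≤-trans (m≤n+m (z + z) y) (≤-reflexive (sym eq))) p
    z< = ≤-<-trans (m≤m+n z z) 2z<

  mul-runs : ∀ x y → x < 2 ^ M → x * y < 2 ^ M →
             MUL $ ⌜ x ⌝ ∷ ⌜ y ⌝ ∷ [] ⇓ ⌜ x * y ⌝ ⟨ mulC ⟩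
  mul-runs x y x< p =
    relax (*-monoˡ-≤ (suc (addC + addC)) (s≤s (size-fromℕ {M} x x<)))
      (outputs (cong (λ z → ⌜ z * y ⌝) (ᵇ.toℕ-fromℕ x))
        (mulᵇ-runs (fromℕ x) y (subst (λ z → z * y < 2 ^ M) (sym (ᵇ.toℕ-fromℕ x)) p)))

  treeSize-⌜⌝ : ∀ x → x < 2 ^ M → treeSize ⌜ x ⌝ ≤ eqC
  treeSize-⌜⌝ x x< = ≤-trans (treeSize-⌜⌝ᵇ (fromℕ x)) (s≤s (*-monoʳ-≤ 4 (size-fromℕ {M} x x<)))

  eqℕ-runs : ∀ x y → x < 2 ^ M →
             EQ $ ⌜ x ⌝ ∷ ⌜ y ⌝ ∷ [] ⇓ encodeBool (does (x ≟ y)) ⟨ eqC ⟩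
  eqℕ-runs x y x< = relax (treeSize-⌜⌝ x x<)
    (outputs (cong encodeBool (eqᵀ-does ⌜_⌝ ⌜⌝-injective (x ≟ y))) (eq-runs ⌜ x ⌝ ⌜ y ⌝))

  treeSize-encodeKey : ∀ {k} (s : Key k) → Small s →
                       treeSize (encodeKey s) ≤ suc (k * suc (suc (eqC + eqC)))
  treeSize-encodeKey []            []             = ≤-refl
  treeSize-encodeKey {suc k} ((x , S) ∷ s) ((x< , S≤) ∷ p) =
    ≤-trans (s≤s (+-mono-≤
      (s≤s (+-mono-≤ (treeSize-⌜⌝ x (m<1+n⇒m≤n (m<n⇒m<1+n x<)))
                     (≤-trans (treeSize-encodeSet S) (s≤s (*-monoʳ-≤ 4 S≤)))))
      (treeSize-encodeKey s p)))
      (≤-reflexive (cong suc (+-suc (suc (eqC + eqC)) (k * suc (suc (eqC + eqC))))))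

  eqKey-runs : ∀ {k} (s t : Key k) → k ≤ M → Small s →
               EQ $ encodeKey s ∷ encodeKey t ∷ [] ⇓ encodeBool (does (s ≟ᴷ t)) ⟨ keyC ⟩
  eqKey-runs s t k≤M p =
    relax (≤-trans (treeSize-encodeKey s p) (s≤s (*-monoˡ-≤ (suc (suc (eqC + eqC))) k≤M)))
      (outputs (cong encodeBool (eqᵀ-does encodeKey encodeKey-injective (s ≟ᴷ t))) (eq-runs (encodeKey s) (encodeKey t)))

  combine-runs : ∀ {k} (s t : Key k) → k ≤ M → Small s → Small t →
                 COMBINE $ encodeKey s ∷ encodeKey t ∷ [] ⇓ encodeKey (combine s t) ⟨ combineC ⟩
  combine-runs s t k≤M p q = relax (*-monoˡ-≤ (suc (addC + suc M)) (s≤s k≤M)) (go s t p q)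
    where
    go : ∀ {k} (s t : Key k) → Small s → Small t →
         COMBINE $ encodeKey s ∷ encodeKey t ∷ [] ⇓ encodeKey (combine s t)
           ⟨ suc k * suc (addC + suc M) ⟩
    go []            []            []               []               = relax (s≤s z≤n) (proc ret)
    go {suc k} ((x , S) ∷ s) ((y , T) ∷ t) ((x< , S≤) ∷ p) ((y< , T≤) ∷ q) =
      relax (≤-reflexive (cong suc (sym (+-assoc addC (suc M) (suc k * suc (addC + suc M))))))
        (proc (add-runs x y (m<n⇒m≤1+n′ x<) (m<n⇒m≤1+n′ y<) ⨾
               relax (s≤s S≤) (union-runs S T) ⨾ last (go s t p q) refl))
      where
      m<n⇒m≤1+n′ : ∀ {x} → suc x < 2 ^ M → x < 2 ^ M
      m<n⇒m≤1+n′ = <-trans (n<1+n _)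

-- The number of rows of a table

AllPairs-lookup-injective : ∀ {A B : Set} {f : A → B} {xs : List A} →
  AllPairs (λ x y → f x ≢ f y) xs → ∀ {i j} →
  f (List.lookup xs i) ≡ f (List.lookup xs j) → i ≡ j
AllPairs-lookup-injective (p ∷ ps) {zero}  {zero}  eq = refl
AllPairs-lookup-injective (p ∷ ps) {zero}  {suc j} eq = contradiction eq (All.lookup p (∈-lookup j))
AllPairs-lookup-injective (p ∷ ps) {suc i} {zero}  eq = contradiction (sym eq) (All.lookup p (∈-lookup i))
AllPairs-lookup-injective (p ∷ ps) {suc i} {suc j} eq = cong suc (AllPairs-lookup-injective ps eq)

-- Each position of `xs` is sent to a position of its image in `ys`. Looking up there recovers the
-- image, and the images are distinct, so this map of positions is injective.
length-≤ : ∀ {A B : Set} {f : A → B} {xs : List A} {ys : List B} →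
           AllPairs (λ x y → f x ≢ f y) xs → All (λ x → f x ∈ ys) xs → length xs ≤ length ys
length-≤ {f = f} {xs} {ys} unique all =
  injective⇒≤ {f = λ i → Any.index (mem i)} λ {i} {j} eq →
    AllPairs-lookup-injective unique (trans (Any.lookup-index (mem i))
      (trans (cong (List.lookup ys) eq) (sym (Any.lookup-index (mem j)))))
  where
  mem : ∀ i → f (List.lookup xs i) ∈ ys
  mem i = All.lookup all (∈-lookup i)

Unique : ∀ {k} → Table k → Set
Unique = AllPairs λ r r′ → proj₁ r ≢ proj₁ r′

AllKeys : ∀ {k} → (Key k → Set) → Table k → Set
AllKeys P = All (P ∘ proj₁)

ValidEntry : ℕ → ℕ → Entry → Set
ValidEntry n w (x , S) = x ≤ n × length S ≤ w

Valid : ∀ {k} → ℕ → ℕ → Key k → Set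
Valid n w = VecAll (ValidEntry n w)

sets : ℕ → List (List Bool)
sets zero    = [] ∷ []
sets (suc w) = [] ∷ (List.map (false ∷_) (sets w) List.++ List.map (true ∷_) (sets w))

∈-sets : ∀ {w} S → length S ≤ w → S ∈ sets w
∈-sets {zero}  []          _       = here refl
∈-sets {suc w} []          _       = here refl
∈-sets {suc w} (false ∷ S) (s≤s p) = there (∈-++⁺ˡ (∈-map⁺ (false ∷_) (∈-sets S p)))
∈-sets {suc w} (true ∷ S)  (s≤s p) =
  there (∈-++⁺ʳ (List.map (false ∷_) (sets w)) (∈-map⁺ (true ∷_) (∈-sets S p)))

-- All lengths from 0 to `w` occur, which gives `1 + 2 + ... + 2 ^ w` lists. This is the origin of
-- the exponent `suc w` in the bound on keys.
length-sets : ∀ w → suc (length (sets w)) ≡ 2 ^ suc w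
length-sets zero    = refl
length-sets (suc w) = begin
  2 + length (List.map (false ∷_) (sets w) List.++ List.map (true ∷_) (sets w))
    ≡⟨ cong (2 +_) (List.length-++ (List.map (false ∷_) (sets w))) ⟩
  2 + (length (List.map (false ∷_) (sets w)) + length (List.map (true ∷_) (sets w)))
    ≡⟨ cong₂ (λ a b → 2 + (a + b)) (List.length-map _ (sets w)) (List.length-map _ (sets w)) ⟩
  2 + (length (sets w) + length (sets w))
    ≡⟨ double (length (sets w)) ⟩
  2 * suc (length (sets w))
    ≡⟨ cong (2 *_) (length-sets w) ⟩
  2 ^ (2 + w) ∎
  where
  open ≡-Reasoning
  double : ∀ n → 2 + (n + n) ≡ 2 * suc n
  double = solve-∀

entries : ℕ → ℕ → List Entry
entries n w = List.cartesianProduct (List.upTo (suc n)) (sets w)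

validKeys : ∀ k → ℕ → ℕ → List (Key k)
validKeys zero    n w = [] ∷ []
validKeys (suc k) n w = List.cartesianProductWith _∷_ (entries n w) (validKeys k n w)

∈-validKeys : ∀ {k n w} {s : Key k} → Valid n w s → s ∈ validKeys k n w
∈-validKeys []             = here refl
∈-validKeys ((p , q) ∷ ps) = ∈-cartesianProductWith⁺ _∷_
  (∈-cartesianProduct⁺ (∈-upTo⁺ (s≤s p)) (∈-sets _ q)) (∈-validKeys ps)

length-cartesianProductWith : ∀ {A B C : Set} (f : A → B → C) xs ys →
  length (List.cartesianProductWith f xs ys) ≡ length xs * length ys
length-cartesianProductWith f []       ys = refl
length-cartesianProductWith f (x ∷ xs) ys =
  trans (List.length-++ (List.map (f x) ys))
        (cong₂ _+_ (List.length-map (f x) ys) (length-cartesianProductWith f xs ys))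

length-validKeys : ∀ k n w → length (validKeys k n w) ≤ (suc n * 2 ^ suc w) ^ k
length-validKeys zero    n w = ≤-refl
length-validKeys (suc k) n w = ≤-trans
  (≤-reflexive (length-cartesianProductWith _∷_ (entries n w) (validKeys k n w)))
  (*-mono-≤ (≤-trans
    (≤-reflexive (trans (length-cartesianProductWith _,_ (List.upTo (suc n)) (sets w))
                        (cong (_* length (sets w)) (List.length-upTo (suc n)))))
    (*-monoʳ-≤ (suc n) (≤-trans (n≤1+n _) (≤-reflexive (length-sets w)))))
    (length-validKeys k n w))

length-table : ∀ {k n w} {T : Table k} → Unique T → AllKeys (Valid n w) T →
               length T ≤ (suc n * 2 ^ suc w) ^ k
length-table {k} {n} {w} u v = ≤-trans (length-≤ u (All.map ∈-validKeys v)) (length-validKeys k n w)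

insert-AllKeys : ∀ {k} {P : Key k → Set} {s c T} → P s → AllKeys P T → AllKeys P (insert s c T)
insert-AllKeys                     p []       = p ∷ []
insert-AllKeys {s = s} {T = (t , _) ∷ _} p (q ∷ qs) with does (s ≟ᴷ t)
... | true  = q ∷ qs
... | false = q ∷ insert-AllKeys p qs

insert-Unique : ∀ {k} {s : Key k} {c T} → Unique T → Unique (insert s c T)
insert-Unique [] = [] ∷ []
insert-Unique {s = s} {T = (t , _) ∷ _} (u ∷ us) with s ≟ᴷ t
... | yes _   = u ∷ us
... | no  s≢t = insert-AllKeys (s≢t ∘ sym) u ∷ insert-Unique us

-- The number of colorings that a table represents. No single counter exceeds it, so it controls the
-- length of all numerals.
mass : ∀ {k} → Table k → ℕ
mass []            = 0
mass ((_ , c) ∷ T) = c + mass T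

-- Merging rows with equal keys leaves these sums unchanged, so they see only what the table means.
-- The constant 1 gives `mass`, and the indicator of equitability gives `total`.
weight : ∀ {k} → (Key k → ℕ) → Table k → ℕ
weight h []            = 0
weight h ((s , c) ∷ T) = c * h s + weight h T

weight-1 : ∀ {k} (T : Table k) → weight (λ _ → 1) T ≡ mass T
weight-1 []            = refl
weight-1 ((_ , c) ∷ T) = cong₂ _+_ (*-identityʳ c) (weight-1 T)

weight-insert : ∀ {k} h (s : Key k) c T → weight h (insert s c T) ≡ c * h s + weight h T
weight-insert h s c [] = refl
weight-insert h s c ((t , d) ∷ T) with s ≟ᴷ t
... | yes refl = trans (cong (_+ weight h T) (*-distribʳ-+ (h s) c d)) (+-assoc (c * h s) _ _)
... | no  _    = trans (cong (d * h t +_) (weight-insert h s c T)) (swap (d * h t) (c * h s) (weight h T))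
  where
  swap : ∀ a b c → a + (b + c) ≡ b + (a + c)
  swap = solve-∀

weight-insertAll : ∀ {k} h (T acc : Table k) → weight h (insertAll T acc) ≡ weight h T + weight h acc
weight-insertAll h []            acc = refl
weight-insertAll h ((s , c) ∷ T) acc = trans (weight-insertAll h T (insert s c acc))
  (trans (cong (weight h T +_) (weight-insert h s c acc)) (swap (weight h T) (c * h s) (weight h acc)))
  where
  swap : ∀ a b c → a + (b + c) ≡ (b + a) + c
  swap = solve-∀

mass-insert : ∀ {k} (s : Key k) c T → mass (insert s c T) ≡ c + mass T
mass-insert s c T = trans (sym (weight-1 (insert s c T)))
  (trans (weight-insert (λ _ → 1) s c T) (cong₂ _+_ (*-identityʳ c) (weight-1 T)))

mass-insertAll : ∀ {k} (T acc : Table k) → mass (insertAll T acc) ≡ mass T + mass acc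
mass-insertAll T acc = trans (sym (weight-1 (insertAll T acc)))
  (trans (weight-insertAll (λ _ → 1) T acc) (cong₂ _+_ (weight-1 T) (weight-1 acc)))

mass-row : ∀ {k} (s : Key k) c T → mass (rowTable s c T) ≡ c * mass T
mass-row s c []            = sym (*-zeroʳ c)
mass-row s c ((_ , d) ∷ T) = trans (cong (c * d +_) (mass-row s c T)) (sym (*-distribˡ-+ c d (mass T)))

-- The invariant behind `length-table`: the keys are distinct and all belong to the finite list
-- `validKeys`.
record Ready {k} (n w : ℕ) (T : Table k) : Set where
  constructor ready
  field
    unique : Unique T
    valid  : AllKeys (Valid n w) T
open Ready public

insert-Ready : ∀ {k n w} {s : Key k} {c T} → Valid n w s → Ready n w T → Ready n w (insert s c T)
insert-Ready p (ready u v) = ready (insert-Unique u) (insert-AllKeys p v)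

insertAll-Ready : ∀ {k n w} {T acc : Table k} → AllKeys (Valid n w) T → Ready n w acc →
                  Ready n w (insertAll T acc)
insertAll-Ready []       r = r
insertAll-Ready (p ∷ ps) r = insertAll-Ready ps (insert-Ready p r)

combine-Valid : ∀ {k m n w} {s t : Key k} → Valid m w s → Valid n w t → Valid (m + n) w (combine s t)
combine-Valid []                         []                           = []
combine-Valid (_∷_ {x = x , S} (p , q) ps) (_∷_ {x = y , T} (p′ , q′) ps′) =
  (+-mono-≤ p p′ , length-∪ S T q q′) ∷ combine-Valid ps ps′

row-Valid : ∀ {k m n w} {s : Key k} {c T} → Valid m w s → AllKeys (Valid n w) T →
            AllKeys (Valid (m + n) w) (rowTable s c T)
row-Valid p []       = []
row-Valid p (q ∷ qs) = combine-Valid p q ∷ row-Valid p qs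

product-Ready : ∀ {k m n w} {S T acc : Table k} → AllKeys (Valid m w) S → AllKeys (Valid n w) T →
                Ready (m + n) w acc → Ready (m + n) w (product S T acc)
product-Ready []       qs r = r
product-Ready (p ∷ ps) qs r = product-Ready ps qs (insertAll-Ready (row-Valid p qs) r)

relabelSet-length : ∀ {w} i j S → j < w → length S ≤ w → length (relabelSet i j S) ≤ w
relabelSet-length {w} i j S j<w p with member i S
... | true  = length-∪ (remove i S) (single j) (subst (_≤ w) (sym (length-remove i S)) p)
                (subst (_≤ w) (sym (length-single j)) j<w)
... | false = p

relabelKey-Valid : ∀ {k n w i j} {s : Key k} → j < w → Valid n w s →
                   Valid n w (Vec.map (relabelEntry i j) s)
relabelKey-Valid j<w []                         = []
relabelKey-Valid j<w (_∷_ {x = x , S} (p , q) ps) =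
  (p , relabelSet-length _ _ S j<w q) ∷ relabelKey-Valid j<w ps

relabel-Valid : ∀ {k n w i j} {T : Table k} → j < w → AllKeys (Valid n w) T →
                AllKeys (Valid n w) (relabelTable i j T)
relabel-Valid j<w []       = []
relabel-Valid j<w (p ∷ ps) = relabelKey-Valid j<w p ∷ relabel-Valid j<w ps

join-Valid : ∀ {k n w i j} {T : Table k} → AllKeys (Valid n w) T →
             AllKeys (Valid n w) (joinTable i j T)
join-Valid [] = []
join-Valid {i = i} {j} {T = (s , _) ∷ _} (p ∷ ps) with bad i j s
... | true  = join-Valid ps
... | false = p ∷ join-Valid ps

zeros-Valid : ∀ k {n w} → Valid n w (zeros k)
zeros-Valid zero    = []
zeros-Valid (suc k) = (z≤n , z≤n) ∷ zeros-Valid k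

consAll-Valid : ∀ {k n w} {T : Table k} → AllKeys (Valid n w) T → AllKeys (Valid n w) (consAll T)
consAll-Valid []       = []
consAll-Valid (p ∷ ps) = ((z≤n , z≤n) ∷ p) ∷ consAll-Valid ps

consAll-≢ : ∀ {k} {s : Key k} {T : Table k} → AllKeys (s ≢_) T → AllKeys (((0 , []) ∷ s) ≢_) (consAll T)
consAll-≢ []       = []
consAll-≢ (p ∷ ps) = p ∘ Vec.∷-injectiveʳ ∷ consAll-≢ ps

consAll-Unique : ∀ {k} {T : Table k} → Unique T → Unique (consAll T)
consAll-Unique []       = []
consAll-Unique (u ∷ us) = consAll-≢ u ∷ consAll-Unique us

consAll-fresh : ∀ {k x} {s : Key k} (T : Table k) → x ≢ (0 , []) → AllKeys ((x ∷ s) ≢_) (consAll T)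
consAll-fresh []      x≢0 = []
consAll-fresh (_ ∷ T) x≢0 = x≢0 ∘ Vec.∷-injectiveˡ ∷ consAll-fresh T x≢0

-- As `x` differs from the empty entry, its position can be read off the key, and so the `k` keys
-- are distinct.
units-Ready : ∀ k {n w x} → x ≢ (0 , []) → ValidEntry n w x → Ready n w (units k x)
units-Ready zero    x≢0 p = ready [] []
units-Ready (suc k) {x = x} x≢0 p with units-Ready k x≢0 p
... | ready u v = ready (consAll-fresh (units k x) x≢0 ∷ consAll-Unique u)
                        ((p ∷ zeros-Valid k) ∷ consAll-Valid v)

-- Calls made by the procedures on tables

module TableProcedures (n w k M : ℕ) (n< : suc n < 2 ^ M) (w≤M : w ≤ M) (k≤M : k ≤ M)
                       (keys≤M : (suc n * 2 ^ suc w) ^ k ≤ M) where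
  open Bounded M

  small : ∀ {k} {s : Key k} → Valid n w s → Small s
  small = VecAll.map λ (p , q) → ≤-<-trans (s≤s p) n< , ≤-trans q w≤M

  rows≤M : ∀ {T : Table k} → Ready n w T → length T ≤ M
  rows≤M r = ≤-trans (length-table (unique r) (valid r)) keys≤M

  insert-runs : ∀ (s : Key k) c T → Valid n w s → Ready n w T → c + mass T < 2 ^ M →
                INSERT $ encodeKey s ∷ ⌜ c ⌝ ∷ encodeTable T ∷ [] ⇓ encodeTable (insert s c T) ⟨ insertC ⟩
  insert-runs s c T p r c< = relax (*-monoˡ-≤ (suc (keyC + addC)) (s≤s (rows≤M r))) (go T c<)
    where
    go : ∀ T → c + mass T < 2 ^ M →
         INSERT $ encodeKey s ∷ ⌜ c ⌝ ∷ encodeTable T ∷ [] ⇓ encodeTable (insert s c T)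
           ⟨ suc (length T) * suc (keyC + addC) ⟩
    go []            c< = relax (s≤s z≤n) (proc ret)
    go ((t , d) ∷ T) c< = step (does (s ≟ᴷ t)) (eqKey-runs s t k≤M (small p))
      where
      step : ∀ b → EQ $ encodeKey s ∷ encodeKey t ∷ [] ⇓ encodeBool b ⟨ keyC ⟩ →
             INSERT $ encodeKey s ∷ ⌜ c ⌝ ∷ encodeTable ((t , d) ∷ T) ∷ []
               ⇓ encodeTable (if b then (t , c + d) ∷ T else (t , d) ∷ insert s c T)
               ⟨ suc (suc (length T)) * suc (keyC + addC) ⟩
      step true  e = relax (m≤m+n _ _) (proc (e ⨾ last (add-runs c d
        (≤-<-trans (m≤m+n c _) c<)
        (≤-<-trans (≤-trans (m≤m+n d (mass T)) (m≤n+m _ c)) c<)) refl))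
      step false e = relax (s≤s (+-monoˡ-≤ _ (m≤m+n keyC addC))) (proc (e ⨾ last (go T
        (≤-<-trans (+-monoʳ-≤ c (m≤n+m (mass T) d)) c<)) refl))

  -- The last hypothesis is a loop invariant: its first summand is what the remaining rows will
  -- contribute, its second what the accumulator holds, and an insertion only moves `c * d` from one
  -- to the other. The loops in `prod-runs`, `relabel-runs` and `join-runs` are bounded in the same
  -- way, except that a rejected row of `join-runs` is dropped and the sum may decrease.
  row-runs : ∀ {m₁ m₂} (s : Key k) c T acc → m₁ + m₂ ≡ n → Valid m₁ w s → Ready m₂ w T →
             Ready n w acc → c < 2 ^ M → c * mass T + mass acc < 2 ^ M →
             ROW $ encodeKey s ∷ ⌜ c ⌝ ∷ encodeTable T ∷ encodeTable acc ∷ []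
               ⇓ encodeTable (insertAll (rowTable s c T) acc) ⟨ rowC ⟩
  row-runs {m₁} {m₂} s c T acc refl p (ready u v) r c< q =
    relax (*-monoˡ-≤ (suc (combineC + (mulC + insertC))) (s≤s (rows≤M (ready u (All.map (widen (m≤n+m m₂ m₁)) v)))))
      (go T acc v r q)
    where
    widen : ∀ {m k} {s : Key k} → m ≤ m₁ + m₂ → Valid m w s → Valid (m₁ + m₂) w s
    widen m≤ = VecAll.map λ (p , q) → ≤-trans p m≤ , q
    go : ∀ T acc → AllKeys (Valid m₂ w) T → Ready (m₁ + m₂) w acc → c * mass T + mass acc < 2 ^ M →
         ROW $ encodeKey s ∷ ⌜ c ⌝ ∷ encodeTable T ∷ encodeTable acc ∷ []
           ⇓ encodeTable (insertAll (rowTable s c T) acc)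
           ⟨ suc (length T) * suc (combineC + (mulC + insertC)) ⟩
    go []            acc []       r q = relax (s≤s z≤n) (proc ret)
    go ((t , d) ∷ T) acc (p′ ∷ v) r q =
      relax (≤-reflexive (assoc combineC mulC insertC (suc (length T) * suc (combineC + (mulC + insertC)))))
        (proc (combine-runs s t k≤M (small (widen (m≤m+n m₁ m₂) p)) (small (widen (m≤n+m m₂ m₁) p′)) ⨾
               mul-runs c d c< (≤-<-trans (m≤m+n (c * d) _) first) ⨾
               insert-runs (combine s t) (c * d) acc (combine-Valid p p′) r first ⨾
               last (go T (insert (combine s t) (c * d) acc) v (insert-Ready (combine-Valid p p′) r)
                        (subst (_< 2 ^ M) eq q)) refl))
      where
      assoc : ∀ a b c d → suc (a + (b + (c + d))) ≡ suc (a + (b + c)) + d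
      assoc = solve-∀
      distrib : ∀ c d m a → c * (d + m) + a ≡ c * m + (c * d + a)
      distrib = solve-∀
      eq : c * (d + mass T) + mass acc ≡ c * mass T + mass (insert (combine s t) (c * d) acc)
      eq = trans (distrib c d (mass T) (mass acc))
                 (cong (c * mass T +_) (sym (mass-insert (combine s t) (c * d) acc)))
      first : c * d + mass acc < 2 ^ M
      first = ≤-<-trans (≤-trans (m≤n+m _ (c * mass T))
        (≤-reflexive (sym (distrib c d (mass T) (mass acc))))) q

  prod-runs : ∀ {m₁ m₂} (S T acc : Table k) → m₁ + m₂ ≡ n → Ready m₁ w S → Ready m₂ w T →
              Ready n w acc → mass S < 2 ^ M → mass S * mass T + mass acc < 2 ^ M →
              PROD $ encodeTable S ∷ encodeTable T ∷ encodeTable acc ∷ []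
                ⇓ encodeTable (product S T acc) ⟨ prodC ⟩
  prod-runs {m₁} {m₂} S T acc refl (ready u v) rT r S< q =
    relax (*-monoˡ-≤ (suc rowC) (s≤s (rows≤M (ready u (All.map (VecAll.map λ (p , q) → ≤-trans p (m≤m+n m₁ m₂) , q) v)))))
      (go S acc v r S< q)
    where
    go : ∀ S acc → AllKeys (Valid m₁ w) S → Ready (m₁ + m₂) w acc → mass S < 2 ^ M →
         mass S * mass T + mass acc < 2 ^ M →
         PROD $ encodeTable S ∷ encodeTable T ∷ encodeTable acc ∷ []
           ⇓ encodeTable (product S T acc) ⟨ suc (length S) * suc rowC ⟩
    go []            acc []      r S< q = relax (s≤s z≤n) (proc ret)
    go ((s , c) ∷ S) acc (p ∷ v) r S< q =
      proc (row-runs s c T acc refl p rT r (≤-<-trans (m≤m+n c (mass S)) S<)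
              (≤-<-trans (≤-trans (m≤n+m _ (mass S * mass T)) (≤-reflexive (sym distributed))) q) ⨾
            last (go S (insertAll (rowTable s c T) acc) v
              (insertAll-Ready (row-Valid p (valid rT)) r)
              (≤-<-trans (m≤n+m (mass S) c) S<)
              (subst (_< 2 ^ M) (trans distributed (cong (mass S * mass T +_) (sym row-mass))) q)) refl)
      where
      distrib : ∀ c s t a → (c + s) * t + a ≡ s * t + (c * t + a)
      distrib = solve-∀
      distributed : (c + mass S) * mass T + mass acc ≡ mass S * mass T + (c * mass T + mass acc)
      distributed = distrib c (mass S) (mass T) (mass acc)
      row-mass : mass (insertAll (rowTable s c T) acc) ≡ c * mass T + mass acc
      row-mass = trans (mass-insertAll (rowTable s c T) acc) (cong (_+ mass acc) (mass-row s c T))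

  relabelSet-runs : ∀ i j S → j < w → length S ≤ w →
    RELABELSET $ unary i ∷ unary j ∷ encodeSet S ∷ [] ⇓ encodeSet (relabelSet i j S) ⟨ relabelSetC ⟩
  relabelSet-runs i j S j<w S≤w = step (member i S) (member-runs′ i S S≤M)
    where
    S≤M = ≤-trans S≤w w≤M
    member-runs′ : ∀ i S → length S ≤ M → MEMBER $ unary i ∷ encodeSet S ∷ [] ⇓ encodeBool (member i S) ⟨ suc M ⟩
    member-runs′ i S p = relax (s≤s p) (member-runs i S)
    step : ∀ b → MEMBER $ unary i ∷ encodeSet S ∷ [] ⇓ encodeBool b ⟨ suc M ⟩ →
           RELABELSET $ unary i ∷ unary j ∷ encodeSet S ∷ []
             ⇓ encodeSet (if b then remove i S ∪ single j else S) ⟨ relabelSetC ⟩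
    step true  e = proc (e ⨾ relax (s≤s S≤M) (remove-runs i S) ⨾
      relax (≤-trans j<w (≤-trans w≤M (n≤1+n M))) (single-runs j) ⨾
      last (relax (s≤s (subst (_≤ M) (sym (length-remove i S)) S≤M)) (union-runs (remove i S) (single j))) refl)
    step false e = relax (s≤s (m≤m+n (suc M) _)) (proc (last e refl))

  relabelKey-runs : ∀ i j (s : Key k) → j < w → Valid n w s →
    RELABELKEY $ unary i ∷ unary j ∷ encodeKey s ∷ [] ⇓ encodeKey (Vec.map (relabelEntry i j) s) ⟨ relabelKeyC ⟩
  relabelKey-runs i j s j<w p = relax (*-monoˡ-≤ (suc relabelSetC) (s≤s k≤M)) (go s p)
    where
    go : ∀ {k} (s : Key k) → Valid n w s →
         RELABELKEY $ unary i ∷ unary j ∷ encodeKey s ∷ []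
           ⇓ encodeKey (Vec.map (relabelEntry i j) s) ⟨ suc k * suc relabelSetC ⟩
    go []            []            = relax (s≤s z≤n) (proc ret)
    go ((x , S) ∷ s) ((p , q) ∷ v) = proc (relabelSet-runs i j S j<w q ⨾ last (go s v) refl)

  relabel-runs : ∀ i j (T : Table k) → j < w → Ready n w T → mass T < 2 ^ M →
    RELABEL $ unary i ∷ unary j ∷ encodeTable T ∷ nil ∷ []
      ⇓ encodeTable (insertAll (relabelTable i j T) []) ⟨ relabelC ⟩
  relabel-runs i j T j<w r T< =
    relax (*-monoˡ-≤ (suc (relabelKeyC + insertC)) (s≤s (rows≤M r)))
      (go T [] (valid r) (ready [] []) (subst (_< 2 ^ M) (sym (+-identityʳ (mass T))) T<))
    where
    go : ∀ T acc → AllKeys (Valid n w) T → Ready n w acc → mass T + mass acc < 2 ^ M →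
         RELABEL $ unary i ∷ unary j ∷ encodeTable T ∷ encodeTable acc ∷ []
           ⇓ encodeTable (insertAll (relabelTable i j T) acc)
           ⟨ suc (length T) * suc (relabelKeyC + insertC) ⟩
    go []            acc []      r q = relax (s≤s z≤n) (proc ret)
    go ((s , c) ∷ T) acc (p ∷ v) r q =
      relax (≤-reflexive (cong suc (sym (+-assoc relabelKeyC insertC (suc (length T) * suc (relabelKeyC + insertC))))))
        (proc (relabelKey-runs i j s j<w p ⨾
               insert-runs s′ c acc (relabelKey-Valid j<w p) r
                 (≤-<-trans (+-monoˡ-≤ (mass acc) (m≤m+n c (mass T))) q) ⨾
               last (go T (insert s′ c acc) v (insert-Ready (relabelKey-Valid j<w p) r)
                 (subst (_< 2 ^ M) eq q)) refl))
      where
      s′ = Vec.map (relabelEntry i j) s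
      swap : ∀ c t a → (c + t) + a ≡ t + (c + a)
      swap = solve-∀
      eq : (c + mass T) + mass acc ≡ mass T + mass (insert s′ c acc)
      eq = trans (swap c (mass T) (mass acc)) (cong (mass T +_) (sym (mass-insert s′ c acc)))

  bad-runs : ∀ i j (s : Key k) → Valid n w s →
             BAD $ unary i ∷ unary j ∷ encodeKey s ∷ [] ⇓ encodeBool (bad i j s) ⟨ badC ⟩
  bad-runs i j s p = relax (*-monoˡ-≤ (suc (suc M + suc M)) (s≤s k≤M)) (go s p)
    where
    go : ∀ {k} (s : Key k) → Valid n w s →
         BAD $ unary i ∷ unary j ∷ encodeKey s ∷ [] ⇓ encodeBool (bad i j s)
           ⟨ suc k * suc (suc M + suc M) ⟩
    go []            []            = relax (s≤s z≤n) (proc ret)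
    go {suc k} ((x , S) ∷ s) ((p , q) ∷ v) = step (member i S) (member j S) (has i) (has j)
      where
      has : ∀ i → MEMBER $ unary i ∷ encodeSet S ∷ [] ⇓ encodeBool (member i S) ⟨ suc M ⟩
      has i = relax (s≤s (≤-trans q w≤M)) (member-runs i S)
      step : ∀ a b → MEMBER $ unary i ∷ encodeSet S ∷ [] ⇓ encodeBool a ⟨ suc M ⟩ →
             MEMBER $ unary j ∷ encodeSet S ∷ [] ⇓ encodeBool b ⟨ suc M ⟩ →
             BAD $ unary i ∷ unary j ∷ encodeKey ((x , S) ∷ s) ∷ []
               ⇓ encodeBool ((a ∧ b) ∨ bad i j s) ⟨ suc (suc k) * suc (suc M + suc M) ⟩
      step true  true  e f = relax (m≤m+n _ _)
        (proc (e ⨾ last f refl))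
      step true  false e f = relax (≤-reflexive (cong suc (sym (+-assoc (suc M) (suc M) (suc k * suc (suc M + suc M))))))
        (proc (e ⨾ f ⨾ last (go s v) refl))
      step false b     e f = relax (s≤s (+-monoˡ-≤ (suc k * suc (suc M + suc M)) (m≤m+n (suc M) (suc M))))
        (proc (e ⨾ last (go s v) refl))

  join-runs : ∀ i j (T : Table k) → Ready n w T → mass T < 2 ^ M →
    JOIN $ unary i ∷ unary j ∷ encodeTable T ∷ nil ∷ []
      ⇓ encodeTable (insertAll (joinTable i j T) []) ⟨ joinC ⟩
  join-runs i j T r T< =
    relax (*-monoˡ-≤ (suc (badC + insertC)) (s≤s (rows≤M r)))
      (go T [] (valid r) (ready [] []) (subst (_< 2 ^ M) (sym (+-identityʳ (mass T))) T<))
    where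
    go : ∀ T acc → AllKeys (Valid n w) T → Ready n w acc → mass T + mass acc < 2 ^ M →
         JOIN $ unary i ∷ unary j ∷ encodeTable T ∷ encodeTable acc ∷ []
           ⇓ encodeTable (insertAll (joinTable i j T) acc)
           ⟨ suc (length T) * suc (badC + insertC) ⟩
    go []            acc []      r q = relax (s≤s z≤n) (proc ret)
    go ((s , c) ∷ T) acc (p ∷ v) r q = step (bad i j s) (bad-runs i j s p)
      where
      swap : ∀ c t a → (c + t) + a ≡ t + (c + a)
      swap = solve-∀
      eq : (c + mass T) + mass acc ≡ mass T + mass (insert s c acc)
      eq = trans (swap c (mass T) (mass acc)) (cong (mass T +_) (sym (mass-insert s c acc)))
      step : ∀ b → BAD $ unary i ∷ unary j ∷ encodeKey s ∷ [] ⇓ encodeBool b ⟨ badC ⟩ →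
             JOIN $ unary i ∷ unary j ∷ encodeTable ((s , c) ∷ T) ∷ encodeTable acc ∷ []
               ⇓ encodeTable (insertAll (if b then joinTable i j T else (s , c) ∷ joinTable i j T) acc)
               ⟨ suc (suc (length T)) * suc (badC + insertC) ⟩
      step true  e = relax (s≤s (+-monoˡ-≤ (suc (length T) * suc (badC + insertC)) (m≤m+n badC insertC)))
        (proc (e ⨾ last (go T acc v r (≤-<-trans (+-monoˡ-≤ (mass acc) (m≤n+m (mass T) c)) q)) refl))
      step false e = relax (≤-reflexive (cong suc (sym (+-assoc badC insertC (suc (length T) * suc (badC + insertC))))))
        (proc (e ⨾ insert-runs s c acc p r (≤-<-trans (+-monoˡ-≤ (mass acc) (m≤m+n c (mass T))) q) ⨾
               last (go T (insert s c acc) v (insert-Ready p r) (subst (_< 2 ^ M) eq q)) refl))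

  units-runs : ∀ x → UNITS $ unary k ∷ encodeEntry x ∷ [] ⇓ encodeTable (units k x) ⟨ unitsC ⟩
  units-runs x = relax (*-monoˡ-≤ (suc (suc M + suc M)) (s≤s k≤M)) (go k k≤M)
    where
    rotate : ∀ a r → suc (a + (r + a)) ≡ suc (a + a) + r
    rotate = solve-∀
    go : ∀ k → k ≤ M → UNITS $ unary k ∷ encodeEntry x ∷ [] ⇓ encodeTable (units k x)
                         ⟨ suc k * suc (suc M + suc M) ⟩
    go zero    _   = relax (s≤s z≤n) (proc ret)
    go (suc k) k<M = relax (≤-reflexive (rotate (suc M) (suc k * suc (suc M + suc M))))
      (proc (relax (s≤s k≤) (zeros-runs k) ⨾ go k k≤ ⨾
             last (relax (s≤s (subst (_≤ M) (sym (length-units k x)) k≤)) (consAll-runs (units k x))) refl))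
      where k≤ = <⇒≤ k<M

  near-runs : ∀ x y → suc x < 2 ^ M → suc y < 2 ^ M →
              NEAR $ ⌜ x ⌝ ∷ ⌜ y ⌝ ∷ [] ⇓ encodeBool (near x y) ⟨ nearC ⟩
  near-runs x y x< y< =
    step (does (x ≟ y)) (does (suc x ≟ y)) (eqℕ-runs x y x<′) (eqℕ-runs (suc x) y x<) (eqℕ-runs x (suc y) x<′)
    where
    x<′ = <-trans (n<1+n x) x<
    suc-runs′ : ∀ x → suc x < 2 ^ M → SUC $ ⌜ x ⌝ ∷ [] ⇓ ⌜ suc x ⌝ ⟨ suc M ⟩
    suc-runs′ x x< = relax (s≤s (size-fromℕ {M} x (<-trans (n<1+n x) x<))) (suc-runs x)
    step : ∀ a b {c} → EQ $ ⌜ x ⌝ ∷ ⌜ y ⌝ ∷ [] ⇓ encodeBool a ⟨ eqC ⟩ →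
           EQ $ ⌜ suc x ⌝ ∷ ⌜ y ⌝ ∷ [] ⇓ encodeBool b ⟨ eqC ⟩ →
           EQ $ ⌜ x ⌝ ∷ ⌜ suc y ⌝ ∷ [] ⇓ encodeBool c ⟨ eqC ⟩ →
           NEAR $ ⌜ x ⌝ ∷ ⌜ y ⌝ ∷ [] ⇓ encodeBool (a ∨ (b ∨ c)) ⟨ nearC ⟩
    step true  b     e f g = relax (s≤s (m≤m+n eqC _)) (proc (last e refl))
    step false true  e f g = relax (s≤s (+-monoʳ-≤ eqC (+-monoʳ-≤ (suc M) (m≤m+n eqC _))))
      (proc (e ⨾ suc-runs′ x x< ⨾ last f refl))
    step false false e f g = proc (e ⨾ suc-runs′ x x< ⨾ f ⨾ suc-runs′ y y< ⨾ last g refl)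

  nearAll-runs : ∀ x (s : Key k) → suc x < 2 ^ M → Valid n w s →
                 NEARALL $ ⌜ x ⌝ ∷ encodeKey s ∷ [] ⇓ encodeBool (nearAll x s) ⟨ suc M * suc nearC ⟩
  nearAll-runs x s x< p = relax (*-monoˡ-≤ (suc nearC) (s≤s k≤M)) (go s p)
    where
    go : ∀ {k} (s : Key k) → Valid n w s →
         NEARALL $ ⌜ x ⌝ ∷ encodeKey s ∷ [] ⇓ encodeBool (nearAll x s) ⟨ suc k * suc nearC ⟩
    go []            []            = relax (s≤s z≤n) (proc ret)
    go {suc k} ((y , S) ∷ s) ((p , q) ∷ v) = step (near x y) (near-runs x y x< (≤-<-trans (s≤s p) n<))
      where
      step : ∀ b → NEAR $ ⌜ x ⌝ ∷ ⌜ y ⌝ ∷ [] ⇓ encodeBool b ⟨ nearC ⟩ →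
             NEARALL $ ⌜ x ⌝ ∷ encodeKey ((y , S) ∷ s) ∷ []
               ⇓ encodeBool (b ∧ nearAll x s) ⟨ suc (suc k) * suc nearC ⟩
      step true  e = proc (e ⨾ last (go s v) refl)
      step false e = relax (m≤m+n _ _) (proc (last e refl))

  equitable-runs : ∀ (s : Key k) → Valid n w s →
                   EQUITABLE $ encodeKey s ∷ encodeKey s ∷ [] ⇓ encodeBool (equitable s s) ⟨ equitableC ⟩
  equitable-runs s p = relax (*-monoˡ-≤ (suc (suc M * suc nearC)) (s≤s k≤M)) (go s p)
    where
    go : ∀ {k} (t : Key k) → Valid n w t →
         EQUITABLE $ encodeKey t ∷ encodeKey s ∷ [] ⇓ encodeBool (equitable t s)
           ⟨ suc k * suc (suc M * suc nearC) ⟩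
    go []            []             = relax (s≤s z≤n) (proc ret)
    go {suc k} ((x , S) ∷ t) ((p′ , q) ∷ v) = step (nearAll x s) (nearAll-runs x s (≤-<-trans (s≤s p′) n<) p)
      where
      step : ∀ b → NEARALL $ ⌜ x ⌝ ∷ encodeKey s ∷ [] ⇓ encodeBool b ⟨ suc M * suc nearC ⟩ →
             EQUITABLE $ encodeKey ((x , S) ∷ t) ∷ encodeKey s ∷ []
               ⇓ encodeBool (b ∧ equitable t s) ⟨ suc (suc k) * suc (suc M * suc nearC) ⟩
      step true  e = proc (e ⨾ last (go t v) refl)
      step false e = relax (m≤m+n _ _) (proc (last e refl))

  total≤mass : ∀ (T : Table k) → total T ≤ mass T
  total≤mass []            = z≤n
  total≤mass ((s , c) ∷ T) with equitable s s
  ... | true  = +-monoʳ-≤ c (total≤mass T)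
  ... | false = ≤-trans (total≤mass T) (m≤n+m _ c)

  total-runs : ∀ (T : Table k) → Ready n w T → mass T < 2 ^ M →
               TOTAL $ encodeTable T ∷ [] ⇓ ⌜ total T ⌝ ⟨ totalC ⟩
  total-runs T r T< = relax (*-monoˡ-≤ (suc (equitableC + addC)) (s≤s (rows≤M r))) (go T (valid r) T<)
    where
    rotate : ∀ e a r → suc (e + (r + a)) ≡ suc (e + a) + r
    rotate = solve-∀
    go : ∀ T → AllKeys (Valid n w) T → mass T < 2 ^ M →
         TOTAL $ encodeTable T ∷ [] ⇓ ⌜ total T ⌝ ⟨ suc (length T) * suc (equitableC + addC) ⟩
    go []            []      q = relax (s≤s z≤n) (proc ret)
    go ((s , c) ∷ T) (p ∷ v) q = step (equitable s s) (equitable-runs s p)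
      where
      q′ = ≤-<-trans (m≤n+m (mass T) c) q
      step : ∀ b → EQUITABLE $ encodeKey s ∷ encodeKey s ∷ [] ⇓ encodeBool b ⟨ equitableC ⟩ →
             TOTAL $ encodeTable ((s , c) ∷ T) ∷ [] ⇓ ⌜ (if b then c + total T else total T) ⌝
               ⟨ suc (suc (length T)) * suc (equitableC + addC) ⟩
      step true  e = relax (≤-reflexive (rotate equitableC addC (suc (length T) * suc (equitableC + addC))))
        (proc (e ⨾ go T v q′ ⨾ last (add-runs c (total T) (≤-<-trans (m≤m+n c _) q)
          (≤-<-trans (total≤mass T) q′)) refl))
      step false e = relax (s≤s (+-monoˡ-≤ (suc (length T) * suc (equitableC + addC)) (m≤m+n equitableC addC)))
        (proc (e ⨾ last (go T v q′) refl))

  unary-runs′ : ∀ m → m ≤ M → UNARY $ ⌜ m ⌝ ∷ [] ⇓ unary m ⟨ unaryC ⟩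
  unary-runs′ m m≤M = outputs (cong unary (ᵇ.toℕ-fromℕ m))
    (relax (s≤s (*-monoʳ-≤ 3 (≤-trans (≤-reflexive (ᵇ.toℕ-fromℕ m)) m≤M))) (unary-runs (fromℕ m)))

-- Booleans and membership in label sets

∧-true⁻ : ∀ a {b} → a ∧ b ≡ true → a ≡ true × b ≡ true
∧-true⁻ true eq = refl , eq

∧-true⁺ : ∀ {a b} → a ≡ true → b ≡ true → a ∧ b ≡ true
∧-true⁺ refl refl = refl

∨-true⁻ : ∀ a {b} → a ∨ b ≡ true → a ≡ true ⊎ b ≡ true
∨-true⁻ true  eq = inj₁ refl
∨-true⁻ false eq = inj₂ eq

∨-true⁺ : ∀ a {b} → a ≡ true ⊎ b ≡ true → a ∨ b ≡ true
∨-true⁺ a (inj₁ refl) = refl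
∨-true⁺ a (inj₂ refl) = ∨-zeroʳ a

not-true : ∀ {a} → ¬ (a ≡ true) → not a ≡ true
not-true {true}  ne = contradiction refl ne
not-true {false} ne = refl

not-true⁻ : ∀ {a} → not a ≡ true → ¬ (a ≡ true)
not-true⁻ {false} _ ()

does-true : ∀ {A : Set} (a? : Dec A) → does a? ≡ true → A
does-true (yes a) _ = a

⌊⌋-true : ∀ {A : Set} (a? : Dec A) → ⌊ a? ⌋ ≡ true → A
⌊⌋-true (yes a) _ = a

⌊⌋-true⁺ : ∀ {A : Set} (a? : Dec A) → A → ⌊ a? ⌋ ≡ true
⌊⌋-true⁺ a? a = trans (isYes≗does a?) (dec-true a? a)

member-∪ : ∀ l S T → member l (S ∪ T) ≡ member l S ∨ member l T
member-∪ l       []      T       = refl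
member-∪ l       (a ∷ S) []      = sym (∨-identityʳ _)
member-∪ zero    (a ∷ S) (b ∷ T) = refl
member-∪ (suc l) (a ∷ S) (b ∷ T) = member-∪ l S T

member-single : ∀ l j → member l (single j) ≡ does (l ≟ j)
member-single zero    zero    = refl
member-single zero    (suc j) = refl
member-single (suc l) zero    = refl
member-single (suc l) (suc j) = member-single l j

member-remove : ∀ l i S → member l (remove i S) ≡ not (does (l ≟ i)) ∧ member l S
member-remove l       i       []      = sym (∧-zeroʳ _)
member-remove zero    zero    (b ∷ S) = refl
member-remove zero    (suc i) (b ∷ S) = refl
member-remove (suc l) zero    (b ∷ S) = refl
member-remove (suc l) (suc i) (b ∷ S) = member-remove l i S

-- Relabelling on labels read as numbers, which is how the program sees them; `toℕ-relabel` makes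
-- the link with the graph operation.
redirect : ℕ → ℕ → ℕ → ℕ
redirect i j l = if does (l ≟ i) then j else l

redirect-≡ : ∀ {i j l} → l ≡ i → redirect i j l ≡ j
redirect-≡ {i} {j} {l} eq = cong (λ b → if b then j else l) (dec-true (l ≟ i) eq)

redirect-≢ : ∀ {i j l} → l ≢ i → redirect i j l ≡ l
redirect-≢ {i} {j} {l} ne = cong (λ b → if b then j else l) (dec-false (l ≟ i) ne)

-- Together with its converse this says that `relabelSet` is the image of the set under `redirect`.
-- If `i` is absent the set is kept, and `redirect` fixes all its members.
member-relabelSet⁻ : ∀ i j S {l} → member l (relabelSet i j S) ≡ true →
                     ∃[ l′ ] member l′ S ≡ true × redirect i j l′ ≡ l
member-relabelSet⁻ i j S {l} p with member i S in i∈S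
... | false = l , p , redirect-≢ λ { refl → contradiction (trans (sym p) i∈S) λ () }
... | true with ∨-true⁻ _ (trans (sym (member-∪ l (remove i S) (single j))) p)
... | inj₂ q = i , i∈S , trans (redirect-≡ {i} refl)
                          (sym (does-true (l ≟ j) (trans (sym (member-single l j)) q)))
... | inj₁ q with ∧-true⁻ (not (does (l ≟ i))) (trans (sym (member-remove l i S)) q)
... | l≢i , l∈S = l , l∈S , redirect-≢ (not-true⁻ l≢i ∘ dec-true (l ≟ i))

member-relabelSet⁺ : ∀ i j S {l} → member l S ≡ true →
                     member (redirect i j l) (relabelSet i j S) ≡ true
member-relabelSet⁺ i j S {l} p with l ≟ i
... | yes refl = trans (cong₂ member (redirect-≡ {l} refl) (cong (λ b → if b then remove l S ∪ single j else S) p))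
  (trans (member-∪ j (remove l S) (single j))
    (∨-true⁺ (member j (remove l S)) (inj₂ (trans (member-single j j) (dec-true (j ≟ j) refl)))))
... | no l≢i = trans (cong (λ x → member x (relabelSet i j S)) (redirect-≢ l≢i)) (kept (member i S))
  where
  kept : ∀ b → member l (if b then remove i S ∪ single j else S) ≡ true
  kept false = p
  kept true  = trans (member-∪ l (remove i S) (single j)) (∨-true⁺ _ (inj₁
    (trans (member-remove l i S) (∧-true⁺ (cong not (dec-false (l ≟ i) l≢i)) p))))

-- Signatures of colorings

unit : ∀ {k} → Fin k → Entry → Key k
unit zero    x = x ∷ zeros _
unit (suc c) x = (0 , []) ∷ unit c x

module _ {k : ℕ} where

  -- Colorings are vectors here: they can be cut by `take` and `drop`, and vectors with equal
  -- entries are equal, which for functions would require extensionality.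
  signature : ∀ {w} (e : Expr w) → Vec (Fin k) (order ⟦ e ⟧) → Key k
  signature (intro i)         (c ∷ []) = unit c (1 , single (toℕ i))
  signature (e ⊕ f)           φ        =
    combine (signature e (take (order ⟦ e ⟧) φ)) (signature f (drop (order ⟦ e ⟧) φ))
  signature (relabel i j _ e) φ        = Vec.map (relabelEntry (toℕ i) (toℕ j)) (signature e φ)
  signature (join i j _ e)    φ        = signature e φ

  accepts : ∀ {w} (e : Expr w) → Vec (Fin k) (order ⟦ e ⟧) → Bool
  accepts (intro i)         φ = true
  accepts (e ⊕ f)           φ =
    accepts e (take (order ⟦ e ⟧) φ) ∧ accepts f (drop (order ⟦ e ⟧) φ)
  accepts (relabel i j _ e) φ = accepts e φ
  accepts (join i j _ e)    φ = accepts e φ ∧ not (bad (toℕ i) (toℕ j) (signature e φ))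

  lookup-split : ∀ m {n} (φ : Vec (Fin k) (m + n)) v →
                 lookup φ v ≡ [ lookup (take m φ) , lookup (drop m φ) ]′ (splitAt m v)
  lookup-split m φ v = trans (cong (λ ψ → lookup ψ v) (sym (Vec.take++drop≡id m φ)))
                             (Vec.lookup-splitAt m (take m φ) (drop m φ) v)

  occurrences : ∀ {n} → Vec (Fin k) n → Fin k → ℕ
  occurrences []      c = 0
  occurrences (d ∷ φ) c = (if does (d Fin.≟ c) then 1 else 0) + occurrences φ c

  occurrences-++ : ∀ {m n} (φ : Vec (Fin k) m) (ψ : Vec (Fin k) n) c →
                   occurrences (φ ++ ψ) c ≡ occurrences φ c + occurrences ψ c
  occurrences-++ []      ψ c = refl
  occurrences-++ (d ∷ φ) ψ c = trans (cong (_ +_) (occurrences-++ φ ψ c))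
    (sym (+-assoc (if does (d Fin.≟ c) then 1 else 0) (occurrences φ c) (occurrences ψ c)))

lookup-zeros : ∀ {k} (c : Fin k) → lookup (zeros k) c ≡ (0 , [])
lookup-zeros c = Vec.lookup-replicate c (0 , [])

unit-size : ∀ {k} (d c : Fin k) S → proj₁ (lookup (unit d (1 , S)) c) ≡ occurrences (d ∷ []) c
unit-size zero    zero    S = refl
unit-size zero    (suc c) S = cong proj₁ (lookup-zeros c)
unit-size (suc d) zero    S = refl
unit-size (suc d) (suc c) S = trans (unit-size d c S) (lemma d c)
  where
  lemma : ∀ {k} (d c : Fin k) → occurrences (d ∷ []) c ≡ occurrences (suc d ∷ []) (suc c)
  lemma d c with d Fin.≟ c
  ... | yes _ = refl
  ... | no  _ = refl

signature-size : ∀ {k w} (e : Expr w) (φ : Vec (Fin k) (order ⟦ e ⟧)) c →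
                 proj₁ (lookup (signature e φ) c) ≡ occurrences φ c
signature-size (intro i) (d ∷ []) c = unit-size d c _
signature-size (e ⊕ f) φ c = begin
  proj₁ (lookup (combine (signature e φ₁) (signature f φ₂)) c)
    ≡⟨ cong proj₁ (Vec.lookup-zipWith combineEntry c (signature e φ₁) (signature f φ₂)) ⟩
  proj₁ (lookup (signature e φ₁) c) + proj₁ (lookup (signature f φ₂) c)
    ≡⟨ cong₂ _+_ (signature-size e φ₁ c) (signature-size f φ₂ c) ⟩
  occurrences φ₁ c + occurrences φ₂ c
    ≡⟨ occurrences-++ φ₁ φ₂ c ⟨
  occurrences (φ₁ ++ φ₂) c
    ≡⟨ cong (λ ψ → occurrences ψ c) (Vec.take++drop≡id (order ⟦ e ⟧) φ) ⟩
  occurrences φ c ∎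
  where
  open ≡-Reasoning
  φ₁ = take (order ⟦ e ⟧) φ
  φ₂ = drop (order ⟦ e ⟧) φ
signature-size (relabel i j _ e) φ c =
  trans (cong proj₁ (Vec.lookup-map c (relabelEntry (toℕ i) (toℕ j)) (signature e φ))) (signature-size e φ c)
signature-size (join i j _ e) φ c = signature-size e φ c

Used : ∀ {k w} (e : Expr w) → Vec (Fin k) (order ⟦ e ⟧) → Fin k → ℕ → Set
Used e φ c l = ∃[ v ] lookup φ v ≡ c × toℕ (lab ⟦ e ⟧ v) ≡ l

labelSet : ∀ {k} → Key k → Fin k → List Bool
labelSet s c = proj₂ (lookup s c)

unit-labels⁻ : ∀ {k} (d c : Fin k) {n S l} → member l (labelSet (unit d (n , S)) c) ≡ true →
               d ≡ c × member l S ≡ true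
unit-labels⁻ zero    zero    p = refl , p
unit-labels⁻ zero    (suc c) {l = l} p =
  contradiction (trans (sym p) (cong (member l ∘ proj₂) (lookup-zeros c))) λ ()
unit-labels⁻ (suc d) (suc c) p with unit-labels⁻ d c p
... | refl , q = refl , q

unit-labels⁺ : ∀ {k} (c : Fin k) {n S} → labelSet (unit c (n , S)) c ≡ S
unit-labels⁺ zero    = refl
unit-labels⁺ (suc c) = unit-labels⁺ c

toℕ-relabel : ∀ {w} (i j l : Fin w) →
              toℕ (if ⌊ l Fin.≟ i ⌋ then j else l) ≡ redirect (toℕ i) (toℕ j) (toℕ l)
toℕ-relabel i j l with l Fin.≟ i
... | yes refl = sym (redirect-≡ {toℕ l} refl)
... | no  l≢i  = sym (redirect-≢ (l≢i ∘ toℕ-injective))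

-- With `signature-labels⁺`, the set stored for a color is exactly the set of labels on its class.
-- `accepts-complete` uses this half: a color with both labels `i` and `j` yields a new edge with
-- equally colored ends. `accepts-sound` uses the other half: such an edge puts both labels into one
-- set.
signature-labels⁻ : ∀ {k w} (e : Expr w) (φ : Vec (Fin k) (order ⟦ e ⟧)) c {l} →
                    member l (labelSet (signature e φ) c) ≡ true → Used e φ c l
signature-labels⁻ (intro i) (d ∷ []) c {l} p with unit-labels⁻ d c p
... | d≡c , q = zero , d≡c , sym (does-true (l ≟ toℕ i) (trans (sym (member-single l (toℕ i))) q))
signature-labels⁻ (e ⊕ f) φ c {l} p
  with ∨-true⁻ _ (trans (sym (member-∪ l (labelSet (signature e φ₁) c) (labelSet (signature f φ₂) c)))
         (trans (sym (cong (member l ∘ proj₂)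
           (Vec.lookup-zipWith combineEntry c (signature e φ₁) (signature f φ₂)))) p))
  where
  φ₁ = take (order ⟦ e ⟧) φ
  φ₂ = drop (order ⟦ e ⟧) φ
... | inj₁ q with signature-labels⁻ e (take (order ⟦ e ⟧) φ) c q
... | v , v∈c , lab-v = v ↑ˡ order ⟦ f ⟧ ,
  trans (lookup-split (order ⟦ e ⟧) φ _) (trans (cong [ _ , _ ]′ split) v∈c) ,
  trans (cong (toℕ ∘ [ lab ⟦ e ⟧ , lab ⟦ f ⟧ ]′) split) lab-v
  where split = Fin.splitAt-↑ˡ (order ⟦ e ⟧) v (order ⟦ f ⟧)
signature-labels⁻ (e ⊕ f) φ c {l} p | inj₂ q with signature-labels⁻ f (drop (order ⟦ e ⟧) φ) c q
... | v , v∈c , lab-v = order ⟦ e ⟧ ↑ʳ v ,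
  trans (lookup-split (order ⟦ e ⟧) φ _) (trans (cong [ _ , _ ]′ split) v∈c) ,
  trans (cong (toℕ ∘ [ lab ⟦ e ⟧ , lab ⟦ f ⟧ ]′) split) lab-v
  where split = Fin.splitAt-↑ʳ (order ⟦ e ⟧) (order ⟦ f ⟧) v
signature-labels⁻ (relabel i j _ e) φ c {l} p
  with member-relabelSet⁻ (toℕ i) (toℕ j) (labelSet (signature e φ) c)
         (trans (sym (cong (member l ∘ proj₂)
           (Vec.lookup-map c (relabelEntry (toℕ i) (toℕ j)) (signature e φ)))) p)
... | l′ , q , refl with signature-labels⁻ e φ c q
... | v , v∈c , refl = v , v∈c , toℕ-relabel i j (lab ⟦ e ⟧ v)
signature-labels⁻ (join i j _ e) φ c p = signature-labels⁻ e φ c p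

signature-labels⁺ : ∀ {k w} (e : Expr w) (φ : Vec (Fin k) (order ⟦ e ⟧)) v →
                    member (toℕ (lab ⟦ e ⟧ v)) (labelSet (signature e φ) (lookup φ v)) ≡ true
signature-labels⁺ (intro i) (d ∷ []) zero = trans (cong (member (toℕ i)) (unit-labels⁺ d))
  (trans (member-single (toℕ i) (toℕ i)) (dec-true (toℕ i ≟ toℕ i) refl))
signature-labels⁺ (e ⊕ f) φ v rewrite lookup-split (order ⟦ e ⟧) φ v
  with splitAt (order ⟦ e ⟧) v
... | inj₁ u = trans (cong (member (toℕ (lab ⟦ e ⟧ u)) ∘ proj₂)
                 (Vec.lookup-zipWith combineEntry (lookup φ₁ u) (signature e φ₁) (signature f φ₂)))
  (trans (member-∪ (toℕ (lab ⟦ e ⟧ u)) (labelSet (signature e φ₁) (lookup φ₁ u)) _)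
    (∨-true⁺ _ (inj₁ (signature-labels⁺ e φ₁ u))))
  where
  φ₁ = take (order ⟦ e ⟧) φ
  φ₂ = drop (order ⟦ e ⟧) φ
... | inj₂ u = trans (cong (member (toℕ (lab ⟦ f ⟧ u)) ∘ proj₂)
                 (Vec.lookup-zipWith combineEntry (lookup φ₂ u) (signature e φ₁) (signature f φ₂)))
  (trans (member-∪ (toℕ (lab ⟦ f ⟧ u)) (labelSet (signature e φ₁) (lookup φ₂ u)) _)
    (∨-true⁺ (member (toℕ (lab ⟦ f ⟧ u)) (labelSet (signature e φ₁) (lookup φ₂ u)))
      (inj₂ (signature-labels⁺ f φ₂ u))))
  where
  φ₁ = take (order ⟦ e ⟧) φ
  φ₂ = drop (order ⟦ e ⟧) φ
signature-labels⁺ (relabel i j _ e) φ v = trans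
  (cong₂ (λ l x → member l (proj₂ x)) (toℕ-relabel i j (lab ⟦ e ⟧ v))
    (Vec.lookup-map (lookup φ v) (relabelEntry (toℕ i) (toℕ j)) (signature e φ)))
  (member-relabelSet⁺ (toℕ i) (toℕ j) (labelSet (signature e φ) (lookup φ v)) (signature-labels⁺ e φ v))
signature-labels⁺ (join i j _ e) φ v = signature-labels⁺ e φ v

bad⁻ : ∀ {k} i j (s : Key k) → bad i j s ≡ true →
       ∃[ c ] member i (labelSet s c) ≡ true × member j (labelSet s c) ≡ true
bad⁻ i j ((_ , S) ∷ s) p with ∨-true⁻ (member i S ∧ member j S) p
... | inj₁ q = zero , ∧-true⁻ (member i S) q
... | inj₂ q with bad⁻ i j s q
... | c , r = suc c , r

bad⁺ : ∀ {k} i j (s : Key k) c → member i (labelSet s c) ≡ true → member j (labelSet s c) ≡ true →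
       bad i j s ≡ true
bad⁺ i j ((_ , S) ∷ s) zero    p q = ∨-true⁺ _ (inj₁ (∧-true⁺ p q))
bad⁺ i j ((_ , S) ∷ s) (suc c) p q = ∨-true⁺ (member i S ∧ member j S) (inj₂ (bad⁺ i j s c p q))

joins⁻ : ∀ {w} (i j a b : Fin w) → joins i j a b ≡ true → (a ≡ i × b ≡ j) ⊎ (b ≡ i × a ≡ j)
joins⁻ i j a b p with ∨-true⁻ (⌊ a Fin.≟ i ⌋ ∧ ⌊ b Fin.≟ j ⌋) p
... | inj₁ q with ∧-true⁻ ⌊ a Fin.≟ i ⌋ q
... | r , s = inj₁ (⌊⌋-true (a Fin.≟ i) r , ⌊⌋-true (b Fin.≟ j) s)
joins⁻ i j a b p | inj₂ q with ∧-true⁻ ⌊ b Fin.≟ i ⌋ q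
... | r , s = inj₂ (⌊⌋-true (b Fin.≟ i) r , ⌊⌋-true (a Fin.≟ j) s)

joins⁺ : ∀ {w} (i j : Fin w) → joins i j i j ≡ true
joins⁺ i j = ∨-true⁺ _ (inj₁ (∧-true⁺ (⌊⌋-true⁺ (i Fin.≟ i) refl) (⌊⌋-true⁺ (j Fin.≟ j) refl)))

accepts-sound : ∀ {k w} (e : Expr w) (φ : Vec (Fin k) (order ⟦ e ⟧)) →
                accepts e φ ≡ true → Proper (graph ⟦ e ⟧) (lookup φ)
accepts-sound (intro i) φ p u v ()
accepts-sound (e ⊕ f) φ p u v
  rewrite lookup-split (order ⟦ e ⟧) φ u | lookup-split (order ⟦ e ⟧) φ v
  with ∧-true⁻ (accepts e (take (order ⟦ e ⟧) φ)) p | splitAt (order ⟦ e ⟧) u | splitAt (order ⟦ e ⟧) v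
... | q , r | inj₁ u′ | inj₁ v′ = accepts-sound e _ q u′ v′
... | q , r | inj₂ u′ | inj₂ v′ = accepts-sound f _ r u′ v′
... | q , r | inj₁ u′ | inj₂ v′ = λ ()
... | q , r | inj₂ u′ | inj₁ v′ = λ ()
accepts-sound (relabel i j _ e) φ p u v = accepts-sound e φ p u v
accepts-sound (join i j _ e) φ p u v edge same
  with ∧-true⁻ (accepts e φ) p | ∨-true⁻ (adj (graph ⟦ e ⟧) u v) edge
... | q , r | inj₁ old = accepts-sound e φ q u v old same
... | q , r | inj₂ new with joins⁻ i j (lab ⟦ e ⟧ u) (lab ⟦ e ⟧ v) new
... | inj₁ (refl , refl) = not-true⁻ r (bad⁺ _ _ (signature e φ) (lookup φ u) (signature-labels⁺ e φ u)
        (subst (λ c → member _ (labelSet (signature e φ) c) ≡ true) (sym same) (signature-labels⁺ e φ v)))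
... | inj₂ (refl , refl) = not-true⁻ r (bad⁺ _ _ (signature e φ) (lookup φ u)
        (subst (λ c → member _ (labelSet (signature e φ) c) ≡ true) (sym same) (signature-labels⁺ e φ v))
        (signature-labels⁺ e φ u))

accepts-complete : ∀ {k w} (e : Expr w) (φ : Vec (Fin k) (order ⟦ e ⟧)) →
                   Proper (graph ⟦ e ⟧) (lookup φ) → accepts e φ ≡ true
accepts-complete (intro i) φ p = refl
accepts-complete (e ⊕ f) φ p = ∧-true⁺
  (accepts-complete e _ λ u v edge same → p (u ↑ˡ n) (v ↑ˡ n)
    (trans (cong₂ (adj⊎ (graph ⟦ e ⟧) (graph ⟦ f ⟧)) (Fin.splitAt-↑ˡ m u n) (Fin.splitAt-↑ˡ m v n)) edge)
    (trans (left u) (trans same (sym (left v)))))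
  (accepts-complete f _ λ u v edge same → p (m ↑ʳ u) (m ↑ʳ v)
    (trans (cong₂ (adj⊎ (graph ⟦ e ⟧) (graph ⟦ f ⟧)) (Fin.splitAt-↑ʳ m n u) (Fin.splitAt-↑ʳ m n v)) edge)
    (trans (right u) (trans same (sym (right v)))))
  where
  m = order ⟦ e ⟧
  n = order ⟦ f ⟧
  left : ∀ u → lookup φ (u ↑ˡ n) ≡ lookup (take m φ) u
  left u = trans (lookup-split m φ (u ↑ˡ n)) (cong [ _ , _ ]′ (Fin.splitAt-↑ˡ m u n))
  right : ∀ u → lookup φ (m ↑ʳ u) ≡ lookup (drop m φ) u
  right u = trans (lookup-split m φ (m ↑ʳ u)) (cong [ _ , _ ]′ (Fin.splitAt-↑ʳ m n u))
accepts-complete (relabel i j _ e) φ p = accepts-complete e φ p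
accepts-complete (join i j i≢j e) φ p = ∧-true⁺
  (accepts-complete e φ λ u v edge → p u v (∨-true⁺ _ (inj₁ edge)))
  (not-true λ b → clash b)
  where
  clash : ¬ (bad (toℕ i) (toℕ j) (signature e φ) ≡ true)
  clash b with bad⁻ (toℕ i) (toℕ j) (signature e φ) b
  ... | c , q , r with signature-labels⁻ e φ c q | signature-labels⁻ e φ c r
  ... | u , u∈c , lab-u | v , v∈c , lab-v = p u v
    (∨-true⁺ (adj (graph ⟦ e ⟧) u v) (inj₂
      (subst₂ (λ a b → joins i j a b ≡ true) (sym (toℕ-injective lab-u)) (sym (toℕ-injective lab-v))
              (joins⁺ i j))))
    (trans u∈c (sym v∈c))

-- The equitability test

near⁻ : ∀ x y → near x y ≡ true → ∣ x - y ∣ ≤ 1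
near⁻ x y p with ∨-true⁻ (does (x ≟ y)) p
... | inj₁ q with does-true (x ≟ y) q
... | refl = ≤-trans (≤-reflexive (∣n-n∣≡0 x)) z≤n
near⁻ x y p | inj₂ q with ∨-true⁻ (does (suc x ≟ y)) q
... | inj₁ r with does-true (suc x ≟ y) r
... | refl = ≤-reflexive (trans (cong (∣ x -_∣) (+-comm 1 x)) (∣m-m+n∣≡n x 1))
near⁻ x y p | inj₂ q | inj₂ r with does-true (x ≟ suc y) r
... | refl = ≤-reflexive (trans (∣-∣-comm (suc y) y) (trans (cong (∣ y -_∣) (+-comm 1 y)) (∣m-m+n∣≡n y 1)))

near⁺ : ∀ x y → ∣ x - y ∣ ≤ 1 → near x y ≡ true
near⁺ zero          zero          p = refl
near⁺ zero          (suc zero)    p = refl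
near⁺ zero          (suc (suc y)) (s≤s ())
near⁺ (suc zero)    zero          p = refl
near⁺ (suc (suc x)) zero          (s≤s ())
near⁺ (suc x)       (suc y)       p = near⁺ x y p

nearAll⁻ : ∀ {k} x (s : Key k) → nearAll x s ≡ true → ∀ c → ∣ x - proj₁ (lookup s c) ∣ ≤ 1
nearAll⁻ x ((y , _) ∷ s) p zero    = near⁻ x y (proj₁ (∧-true⁻ (near x y) p))
nearAll⁻ x ((y , _) ∷ s) p (suc c) = nearAll⁻ x s (proj₂ (∧-true⁻ (near x y) p)) c

nearAll⁺ : ∀ {k} x (s : Key k) → (∀ c → ∣ x - proj₁ (lookup s c) ∣ ≤ 1) → nearAll x s ≡ true
nearAll⁺ x []            p = refl
nearAll⁺ x ((y , _) ∷ s) p = ∧-true⁺ (near⁺ x y (p zero)) (nearAll⁺ x s (p ∘ suc))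

equitable⁻ : ∀ {k l} (t : Key l) (s : Key k) → equitable t s ≡ true →
             ∀ c d → ∣ proj₁ (lookup t c) - proj₁ (lookup s d) ∣ ≤ 1
equitable⁻ ((x , _) ∷ t) s p zero    = nearAll⁻ x s (proj₁ (∧-true⁻ (nearAll x s) p))
equitable⁻ ((x , _) ∷ t) s p (suc c) = equitable⁻ t s (proj₂ (∧-true⁻ (nearAll x s) p)) c

equitable⁺ : ∀ {k l} (t : Key l) (s : Key k) →
             (∀ c d → ∣ proj₁ (lookup t c) - proj₁ (lookup s d) ∣ ≤ 1) → equitable t s ≡ true
equitable⁺ []            s p = refl
equitable⁺ ((x , _) ∷ t) s p = ∧-true⁺ (nearAll⁺ x s (p zero)) (equitable⁺ t s (p ∘ suc))

open Algebra.Properties.CommutativeMonoid.Sum +-0-commutativeMonoid using (sum; sum-cong-≗; sum-permute; sum-replicate-zero)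

indicator : Bool → ℕ
indicator b = if b then 1 else 0

sum-≤ : ∀ {n b} (f : Fin n → ℕ) → (∀ i → f i ≤ b) → sum f ≤ n * b
sum-≤ {zero}  f p = z≤n
sum-≤ {suc n} f p = +-mono-≤ (p zero) (sum-≤ (f ∘ suc) (p ∘ suc))

sum-+ : ∀ m n (f : Fin (m + n) → ℕ) → sum f ≡ sum (f ∘ (_↑ˡ n)) + sum (f ∘ (m ↑ʳ_))
sum-+ zero    n f = refl
sum-+ (suc m) n f = trans (cong (f zero +_) (sum-+ m n (f ∘ suc))) (sym (+-assoc (f zero) _ _))

sum-combine : ∀ m n (f : Fin (m * n) → ℕ) → sum f ≡ sum λ i → sum λ j → f (Fin.combine {m} {n} i j)
sum-combine zero    n f = refl
sum-combine (suc m) n f = trans (sum-+ n (m * n) f) (cong (sum (λ j → f (j ↑ˡ (m * n))) +_) (sum-combine m n (f ∘ (n ↑ʳ_))))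

length-filter-tabulate : ∀ {n} {A : Set} {P : A → Set} (P? : ∀ x → Dec (P x)) (g : Fin n → A) →
                         length (filter P? (tabulate g)) ≡ sum λ i → indicator (does (P? (g i)))
length-filter-tabulate {zero}  P? g = refl
length-filter-tabulate {suc n} P? g with does (P? (g zero))
... | true  = cong suc (length-filter-tabulate P? (g ∘ suc))
... | false = length-filter-tabulate P? (g ∘ suc)

-- Sums over colorings

module _ {k : ℕ} where

  ∑ : ∀ n → (Vec (Fin k) n → ℕ) → ℕ
  ∑ zero    F = F []
  ∑ (suc n) F = sum λ c → ∑ n λ φ → F (c ∷ φ)

  ∑-cong : ∀ n {F G} → (∀ φ → F φ ≡ G φ) → ∑ n F ≡ ∑ n G
  ∑-cong zero    p = p []
  ∑-cong (suc n) p = sum-cong-≗ λ c → ∑-cong n λ φ → p (c ∷ φ)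

  ∑-0 : ∀ n → ∑ n (λ _ → 0) ≡ 0
  ∑-0 zero    = refl
  ∑-0 (suc n) = trans (sum-cong-≗ {k} λ c → ∑-0 n) (sum-replicate-zero k)

  ∑-≤ : ∀ n {F} → (∀ φ → F φ ≤ 1) → ∑ n F ≤ k ^ n
  ∑-≤ zero    p = p []
  ∑-≤ (suc n) p = sum-≤ _ λ c → ∑-≤ n λ φ → p (c ∷ φ)

  ∑-++ : ∀ m n F → ∑ (m + n) F ≡ ∑ m λ φ → ∑ n λ ψ → F (φ ++ ψ)
  ∑-++ zero    n F = refl
  ∑-++ (suc m) n F = sum-cong-≗ λ c → ∑-++ m n λ φ → F (c ∷ φ)

  ∑-if : ∀ n b F → ∑ n (λ φ → if b then F φ else 0) ≡ (if b then ∑ n F else 0)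
  ∑-if n true  F = refl
  ∑-if n false F = ∑-0 n

  -- Passes from the indices of maps, over which the statement counts, to vectors. `g` has to
  -- respect pointwise equality because the map with index `Fin.combine c r` agrees only pointwise
  -- with `c` followed by the map with index `r`.
  ∑-finToFun : ∀ n (g : Map n k → ℕ) → (∀ {φ ψ} → (∀ v → φ v ≡ ψ v) → g φ ≡ g ψ) →
               sum (λ c → g (finToFun {k} {n} c)) ≡ ∑ n (g ∘ lookup)
  ∑-finToFun zero    g g-cong = trans (+-identityʳ _) (g-cong λ ())
  ∑-finToFun (suc n) g g-cong = trans (sum-combine k (k ^ n) _) (sum-cong-≗ λ c →
    trans (sum-cong-≗ λ r → g-cong (head-tail c r))
      (trans (∑-finToFun n (λ ψ → g (c Func.∷ ψ)) λ p → g-cong λ { zero → refl ; (suc v) → p v })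
             (∑-cong n λ φ → g-cong λ { zero → refl ; (suc v) → refl })))
    where
    head-tail : ∀ c r v → finToFun {k} {suc n} (Fin.combine c r) v ≡ (c Func.∷ finToFun r) v
    head-tail c r zero    = cong proj₁ (Fin.remQuot-combine c r)
    head-tail c r (suc v) = cong (λ qr → finToFun (proj₂ qr) v) (Fin.remQuot-combine {k} c r)

take-++ : ∀ {A : Set} m {n} (xs : Vec A m) (ys : Vec A n) → take m (xs ++ ys) ≡ xs
take-++ m xs ys = Vec.++-injectiveˡ (take m (xs ++ ys)) xs (Vec.take++drop≡id m (xs ++ ys))

drop-++ : ∀ {A : Set} m {n} (xs : Vec A m) (ys : Vec A n) → drop m (xs ++ ys) ≡ ys
drop-++ m xs ys = Vec.++-injectiveʳ (take m (xs ++ ys)) xs (Vec.take++drop≡id m (xs ++ ys))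

-- The table of an expression

tableOf : ∀ k {w} → Expr w → Table k
tableOf k (intro i)         = units k (1 , single (toℕ i))
tableOf k (e ⊕ f)           = product (tableOf k e) (tableOf k f) []
tableOf k (relabel i j _ e) = insertAll (relabelTable (toℕ i) (toℕ j) (tableOf k e)) []
tableOf k (join i j _ e)    = insertAll (joinTable (toℕ i) (toℕ j) (tableOf k e)) []

tableOf-Ready : ∀ k {w} (e : Expr w) → Ready (order ⟦ e ⟧) w (tableOf k e)
tableOf-Ready k (intro i)         = units-Ready k (λ ()) (≤-refl , subst (_≤ _) (sym (length-single (toℕ i))) (Fin.toℕ<n i))
tableOf-Ready k (e ⊕ f)           =
  product-Ready (valid (tableOf-Ready k e)) (valid (tableOf-Ready k f)) (ready [] [])
tableOf-Ready k (relabel i j _ e) =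
  insertAll-Ready (relabel-Valid (Fin.toℕ<n j) (valid (tableOf-Ready k e))) (ready [] [])
tableOf-Ready k (join i j _ e)    =
  insertAll-Ready (join-Valid (valid (tableOf-Ready k e))) (ready [] [])

weight-cong : ∀ {k} {h h′ : Key k → ℕ} → (∀ s → h s ≡ h′ s) → ∀ T → weight h T ≡ weight h′ T
weight-cong p []            = refl
weight-cong p ((s , c) ∷ T) = cong₂ (λ x y → c * x + y) (p s) (weight-cong p T)

weight-consAll : ∀ {k} h (T : Table k) → weight h (consAll T) ≡ weight (λ s → h ((0 , []) ∷ s)) T
weight-consAll h []            = refl
weight-consAll h ((s , c) ∷ T) = cong (c * h ((0 , []) ∷ s) +_) (weight-consAll h T)

weight-units : ∀ k x h → weight h (units k x) ≡ sum λ c → h (unit c x)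
weight-units zero    x h = refl
weight-units (suc k) x h = cong₂ _+_ (*-identityˡ _)
  (trans (weight-consAll h (units k x)) (weight-units k x λ s → h ((0 , []) ∷ s)))

weight-row : ∀ {k} h (s : Key k) c T → weight h (rowTable s c T) ≡ c * weight (λ t → h (combine s t)) T
weight-row h s c []            = sym (*-zeroʳ c)
weight-row h s c ((t , d) ∷ T) = trans (cong₂ _+_ (*-assoc c d _) (weight-row h s c T))
  (sym (*-distribˡ-+ c (d * h (combine s t)) _))

weight-product : ∀ {k} h (S T acc : Table k) → weight h (product S T acc) ≡
                 weight (λ s → weight (λ t → h (combine s t)) T) S + weight h acc
weight-product h []            T acc = refl
weight-product h ((s , c) ∷ S) T acc = begin
  weight h (product S T (insertAll (rowTable s c T) acc))
    ≡⟨ weight-product h S T (insertAll (rowTable s c T) acc) ⟩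
  rest + weight h (insertAll (rowTable s c T) acc)
    ≡⟨ cong (rest +_) (trans (weight-insertAll h (rowTable s c T) acc)
                             (cong (_+ weight h acc) (weight-row h s c T))) ⟩
  rest + (c * weight (λ t → h (combine s t)) T + weight h acc)
    ≡⟨ swap rest (c * weight (λ t → h (combine s t)) T) (weight h acc) ⟩
  (c * weight (λ t → h (combine s t)) T + rest) + weight h acc ∎
  where
  open ≡-Reasoning
  rest = weight (λ s → weight (λ t → h (combine s t)) T) S
  swap : ∀ a b c → a + (b + c) ≡ (b + a) + c
  swap = solve-∀

weight-relabel : ∀ {k} h i j (T : Table k) →
                 weight h (relabelTable i j T) ≡ weight (h ∘ Vec.map (relabelEntry i j)) T
weight-relabel h i j []            = refl
weight-relabel h i j ((s , c) ∷ T) = cong (c * h (Vec.map (relabelEntry i j) s) +_) (weight-relabel h i j T)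

weight-join : ∀ {k} h i j (T : Table k) →
              weight h (joinTable i j T) ≡ weight (λ s → if bad i j s then 0 else h s) T
weight-join h i j []            = refl
weight-join h i j ((s , c) ∷ T) with bad i j s
... | true  = trans (weight-join h i j T)
  (cong (_+ weight (λ s → if bad i j s then 0 else h s) T) (sym (*-zeroʳ c)))
... | false = cong (c * h s +_) (weight-join h i j T)

total≡weight : ∀ {k} (T : Table k) → total T ≡ weight (λ s → indicator (equitable s s)) T
total≡weight []            = refl
total≡weight ((s , c) ∷ T) with equitable s s
... | true  = cong₂ _+_ (sym (*-identityʳ c)) (total≡weight T)
... | false = trans (total≡weight T)
  (cong (_+ weight (λ s → indicator (equitable s s)) T) (sym (*-zeroʳ c)))

-- As h is arbitrary, the table represents the multiset of signatures of the proper colorings.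
weight-tableOf : ∀ {k w} (e : Expr w) (h : Key k → ℕ) → weight h (tableOf k e) ≡
                 ∑ (order ⟦ e ⟧) λ φ → if accepts e φ then h (signature e φ) else 0
weight-tableOf {k} (intro i) h = weight-units k _ h
weight-tableOf {k} (e ⊕ f) h = begin
  weight h (product (tableOf k e) (tableOf k f) [])
    ≡⟨ trans (weight-product h (tableOf k e) (tableOf k f) []) (+-identityʳ _) ⟩
  weight (λ s → weight (λ t → h (combine s t)) (tableOf k f)) (tableOf k e)
    -- The hypothesis for `f` is applied at every row `s` of the table of `e`. The inner sum that
    -- results becomes the test function in the hypothesis for `e`, so the induction needs `h` to be
    -- arbitrary.
    ≡⟨ weight-cong (λ s → weight-tableOf f λ t → h (combine s t)) (tableOf k e) ⟩
  weight (λ s → ∑ n λ ψ → if accepts f ψ then h (combine s (signature f ψ)) else 0) (tableOf k e)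
    ≡⟨ weight-tableOf e _ ⟩
  ∑ m (λ φ → if accepts e φ
             then ∑ n (λ ψ → if accepts f ψ then h (combine (signature e φ) (signature f ψ)) else 0)
             else 0)
    ≡⟨ ∑-cong m (λ φ → sym (∑-if n (accepts e φ) _)) ⟩
  ∑ m (λ φ → ∑ n λ ψ → if accepts e φ
                       then (if accepts f ψ then h (combine (signature e φ) (signature f ψ)) else 0)
                       else 0)
    ≡⟨ ∑-cong m (λ φ → ∑-cong n λ ψ → step φ ψ) ⟩
  ∑ m (λ φ → ∑ n λ ψ → F (φ ++ ψ))
    ≡⟨ ∑-++ m n F ⟨
  ∑ (m + n) F ∎
  where
  open ≡-Reasoning
  m = order ⟦ e ⟧
  n = order ⟦ f ⟧
  F : Vec (Fin k) (m + n) → ℕ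
  F φ = if accepts (e ⊕ f) φ then h (signature (e ⊕ f) φ) else 0
  if-∧ : ∀ a b {x} → (if a then (if b then x else 0) else 0) ≡ (if a ∧ b then x else 0)
  if-∧ true  b = refl
  if-∧ false b = refl
  step : ∀ φ ψ → (if accepts e φ
                  then (if accepts f ψ then h (combine (signature e φ) (signature f ψ)) else 0)
                  else 0) ≡ F (φ ++ ψ)
  step φ ψ = trans (if-∧ (accepts e φ) (accepts f ψ))
    (cong₂ (λ φ ψ → if accepts e φ ∧ accepts f ψ then h (combine (signature e φ) (signature f ψ)) else 0)
      (sym (take-++ m φ ψ)) (sym (drop-++ m φ ψ)))
weight-tableOf {k} (relabel i j _ e) h =
  trans (weight-insertAll h (relabelTable (toℕ i) (toℕ j) (tableOf k e)) [])
    (trans (+-identityʳ _) (trans (weight-relabel h (toℕ i) (toℕ j) (tableOf k e)) (weight-tableOf e _)))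
weight-tableOf {k} (join i j _ e) h =
  trans (weight-insertAll h (joinTable (toℕ i) (toℕ j) (tableOf k e)) [])
    (trans (+-identityʳ _) (trans (weight-join h (toℕ i) (toℕ j) (tableOf k e))
      (trans (weight-tableOf e _) (∑-cong (order ⟦ e ⟧) λ φ →
        if-not (accepts e φ) (bad (toℕ i) (toℕ j) (signature e φ))))))
  where
  if-not : ∀ a b {x} → (if a then (if b then 0 else x) else 0) ≡ (if a ∧ not b then x else 0)
  if-not true  true  = refl
  if-not true  false = refl
  if-not false b     = refl

-- With `h` constant 1, the mass is the number of proper colorings, hence at most the number of all
-- maps.
mass-tableOf : ∀ k {w} (e : Expr w) → mass (tableOf k e) ≤ k ^ order ⟦ e ⟧
mass-tableOf k e = ≤-trans
  (≤-reflexive (trans (sym (weight-1 (tableOf k e))) (weight-tableOf e λ _ → 1)))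
  (∑-≤ (order ⟦ e ⟧) λ φ → indicator≤1 (accepts e φ))
  where
  indicator≤1 : ∀ b → indicator b ≤ 1
  indicator≤1 true  = ≤-refl
  indicator≤1 false = z≤n

-- From tables to equitable colorings

classSize≡sum : ∀ {n k} (φ : Map n k) c → classSize φ c ≡ sum λ v → indicator (does (φ v Fin.≟ c))
classSize≡sum φ c = length-filter-tabulate (λ v → φ v Fin.≟ c) id

classSize-lookup : ∀ {n k} (φ : Vec (Fin k) n) c → classSize (lookup φ) c ≡ occurrences φ c
classSize-lookup φ c = trans (classSize≡sum (lookup φ) c) (go φ)
  where
  go : ∀ {n} (φ : Vec _ n) → sum (λ v → indicator (does (lookup φ v Fin.≟ c))) ≡ occurrences φ c
  go []      = refl
  go (d ∷ φ) = cong (indicator (does (d Fin.≟ c)) +_) (go φ)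

signature-classSize : ∀ {k w} (e : Expr w) (φ : Vec (Fin k) (order ⟦ e ⟧)) c →
                      proj₁ (lookup (signature e φ) c) ≡ classSize (lookup φ) c
signature-classSize e φ c = trans (signature-size e φ c) (sym (classSize-lookup φ c))

signature-equitable : ∀ {k w} (e : Expr w) (φ : Vec (Fin k) (order ⟦ e ⟧)) →
                      equitable (signature e φ) (signature e φ) ≡ true ⇔ Equitable (lookup φ)
signature-equitable e φ = mk⇔
  (λ p c d → subst₂ (λ x y → ∣ x - y ∣ ≤ 1) (signature-classSize e φ c) (signature-classSize e φ d)
    (equitable⁻ (signature e φ) (signature e φ) p c d))
  (λ p → equitable⁺ (signature e φ) (signature e φ) λ c d → subst₂ (λ x y → ∣ x - y ∣ ≤ 1)
    (sym (signature-classSize e φ c)) (sym (signature-classSize e φ d)) (p c d))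

total-tableOf : ∀ {k w} (e : Expr w) → total (tableOf k e) ≡
                ∑ (order ⟦ e ⟧) λ φ → indicator (does (equitableColoring? (graph ⟦ e ⟧) (lookup φ)))
total-tableOf {k} e = trans (total≡weight (tableOf k e)) (trans (weight-tableOf e _)
  (∑-cong (order ⟦ e ⟧) λ φ → go (accepts e φ) _ (equitableColoring? (graph ⟦ e ⟧) (lookup φ))
    (mk⇔ (accepts-sound e φ) (accepts-complete e φ)) (signature-equitable e φ)))
  where
  open Equivalence
  go : ∀ a b {A B : Set} (d : Dec (A × B)) → a ≡ true ⇔ A → b ≡ true ⇔ B →
       (if a then indicator b else 0) ≡ indicator (does d)
  go true  true  d f g = cong indicator (sym (dec-true d (to f refl , to g refl)))
  go true  false d f g = cong indicator (sym (dec-false d λ (_ , y) → contradiction (from g y) λ ()))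
  go false b     d f g = cong indicator (sym (dec-false d λ (x , _) → contradiction (from f x) λ ()))

-- Invariance under isomorphism

module _ {m n k : ℕ} {H : Graph m} {G : Graph n} (iso : H ≅ G) {ψ : Map m k} {φ : Map n k}
         (ψ≗φ : ∀ u → ψ u ≡ φ (Inverse.to (_≅_.bijection iso) u)) where

  open _≅_ iso
  open Inverse bijection using (to; from; strictlyInverseˡ)

  classSize-≅ : ∀ c → classSize ψ c ≡ classSize φ c
  classSize-≅ c = begin
    classSize ψ c
      ≡⟨ classSize≡sum ψ c ⟩
    sum (λ v → indicator (does (ψ v Fin.≟ c)))
      ≡⟨ sum-cong-≗ (λ v → cong (λ d → indicator (does (d Fin.≟ c))) (ψ≗φ v)) ⟩
    sum (λ v → indicator (does (φ (to v) Fin.≟ c)))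
      ≡⟨ sum-permute (λ v → indicator (does (φ v Fin.≟ c))) bijection ⟨
    sum (λ v → indicator (does (φ v Fin.≟ c)))
      ≡⟨ classSize≡sum φ c ⟨
    classSize φ c ∎
    where open ≡-Reasoning

  equitableColoring-≅ : EquitableColoring H ψ ⇔ EquitableColoring G φ
  equitableColoring-≅ = mk⇔
    (λ (proper , eq) →
      (λ u v edge same → proper (from u) (from v)
        (trans (preserves (from u) (from v))
          (trans (cong₂ (adj G) (strictlyInverseˡ u) (strictlyInverseˡ v)) edge))
        (trans (pull u) (trans same (sym (pull v))))) ,
      λ c d → subst₂ (λ x y → ∣ x - y ∣ ≤ 1) (classSize-≅ c) (classSize-≅ d) (eq c d))
    (λ (proper , eq) →
      (λ u v edge same → proper (to u) (to v) (trans (sym (preserves u v)) edge)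
        (trans (sym (ψ≗φ u)) (trans same (ψ≗φ v)))) ,
      λ c d → subst₂ (λ x y → ∣ x - y ∣ ≤ 1) (sym (classSize-≅ c)) (sym (classSize-≅ d)) (eq c d))
    where
    pull : ∀ u → ψ (from u) ≡ φ u
    pull u = trans (ψ≗φ (from u)) (cong φ (strictlyInverseˡ u))

-- Applied to the identity, `equitableColoring-≅` says that pointwise equal maps are equitable
-- colorings together, as `∑-finToFun` requires.
≅-refl : ∀ {n} {G : Graph n} → G ≅ G
≅-refl = record { bijection = mk↔ₛ′ id id (λ _ → refl) (λ _ → refl) ; preserves = λ _ _ → refl }

-- Precomposition with the bijection of vertices and with its inverse; it is contravariant, hence
-- the order of `k ^ n` and `k ^ m`. The inverse laws hold because `funToFin` takes pointwise equal
-- maps to the same index.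
maps-↔ : ∀ {m n} k → Fin m ↔ Fin n → Permutation (k ^ n) (k ^ m)
maps-↔ {m} {n} k π = mk↔ₛ′
  (λ c → funToFin (finToFun {k} {n} c ∘ to))
  (λ c → funToFin (finToFun {k} {m} c ∘ from))
  (λ c → trans (funToFin-cong λ v → trans (Fin.finToFun-funToFin (finToFun {k} {m} c ∘ from) (to v))
                                           (cong (finToFun c) (strictlyInverseʳ v)))
               (Fin.funToFin-finToFin {m} c))
  (λ c → trans (funToFin-cong λ v → trans (Fin.finToFun-funToFin (finToFun {k} {n} c ∘ to) (from v))
                                           (cong (finToFun c) (strictlyInverseˡ v)))
               (Fin.funToFin-finToFin {n} c))
  where
  open Inverse π using (to; from; strictlyInverseˡ; strictlyInverseʳ)
  funToFin-cong : ∀ {n} {f g : Fin n → Fin k} → (∀ v → f v ≡ g v) → funToFin f ≡ funToFin g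
  funToFin-cong {zero}  p = refl
  funToFin-cong {suc n} p = cong₂ Fin.combine (p zero) (funToFin-cong (p ∘ suc))

#equitableColorings≡total : ∀ {n k w} (G : Graph n) (e : Expr w) → e Builds G →
                            #equitableColorings k G ≡ total (tableOf k e)
#equitableColorings≡total {n} {k} G e iso = begin
  #equitableColorings k G
    ≡⟨ length-filter-tabulate (λ c → equitableColoring? G (finToFun {k} {n} c)) id ⟩
  sum (λ c → count G (finToFun {k} {n} c))
    ≡⟨ sum-cong-≗ (λ c → cong indicator (does-⇔ (equitableColoring-≅ iso
         (Fin.finToFun-funToFin (finToFun {k} {n} c ∘ to)))
         (equitableColoring? H _) (equitableColoring? G _))) ⟨
  sum (λ c → count H (finToFun {k} {m} (maps-↔ k (_≅_.bijection iso) ⟨$⟩ʳ c)))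
    ≡⟨ sum-permute (λ c → count H (finToFun {k} {m} c)) (maps-↔ k (_≅_.bijection iso)) ⟨
  sum (λ c → count H (finToFun {k} {m} c))
    ≡⟨ ∑-finToFun m (count H) (λ {φ} {ψ} p → cong indicator (does-⇔ (equitableColoring-≅ (≅-refl {G = H}) {φ} {ψ} p)
         (equitableColoring? H _) (equitableColoring? H _))) ⟩
  ∑ m (count H ∘ lookup)
    ≡⟨ total-tableOf e ⟨
  total (tableOf k e) ∎
  where
  open ≡-Reasoning
  H = graph ⟦ e ⟧
  m = order ⟦ e ⟧
  open Inverse (_≅_.bijection iso) using (to)
  count : ∀ {n} → Graph n → Map n k → ℕ
  count G φ = indicator (does (equitableColoring? G φ))

-- Calls made by the whole program

nodeC : ℕ → ℕ
-- A sum and not a maximum: it bounds the work at a node of any kind, and closure of polynomial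
-- bounds under addition applies to it.
nodeC M = suc (unaryC + (unaryC + (suc M + (unitsC + (prodC + (relabelC + joinC))))))
  where open Bounded M

runC : ℕ → ℕ
runC M = unaryC + (M * nodeC M + totalC)
  where open Bounded M

two-subterms : ∀ a b c p → suc p ≤ c → suc (a * c + (b * c + p)) ≤ suc (a + b) * c
two-subterms a b c p p<c = ≤-trans (≤-reflexive (rearrange a b c p)) (+-monoˡ-≤ ((a + b) * c) p<c)
  where
  rearrange : ∀ a b c p → suc (a * c + (b * c + p)) ≡ suc p + (a + b) * c
  rearrange = solve-∀

one-subterm : ∀ a c u r → suc (u + (u + r)) ≤ c → suc (u + (u + (a * c + r))) ≤ suc a * c
one-subterm a c u r p = ≤-trans (≤-reflexive (rearrange a c u r)) (+-monoˡ-≤ (a * c) p)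
  where
  rearrange : ∀ a c u r → suc (u + (u + (a * c + r))) ≡ suc (u + (u + r)) + a * c
  rearrange = solve-∀

summands : ∀ u m t p r q → let c = suc (u + (u + (m + (t + (p + (r + q)))))) in
           suc (u + (m + t)) ≤ c × suc p ≤ c × suc (u + (u + r)) ≤ c × suc (u + (u + q)) ≤ c
summands u m t p r q =
  s≤s (≤-trans (+-monoʳ-≤ u (+-monoʳ-≤ m (m≤m+n t (p + (r + q))))) (m≤n+m _ u)) ,
  s≤s (≤-trans (m≤m+n p (r + q)) (≤-trans rest (≤-trans (m≤n+m _ u) (m≤n+m _ u)))) ,
  s≤s (+-monoʳ-≤ u (+-monoʳ-≤ u (≤-trans (≤-trans (m≤m+n r q) (m≤n+m (r + q) p)) rest))) ,
  s≤s (+-monoʳ-≤ u (+-monoʳ-≤ u (≤-trans (≤-trans (m≤n+m q r) (m≤n+m (r + q) p)) rest)))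
  where
  rest : p + (r + q) ≤ m + (t + (p + (r + q)))
  rest = ≤-trans (m≤n+m _ t) (m≤n+m _ m)

-- `N` bounds the order of the whole graph. Subexpressions have their own smaller order `n`, but `M`
-- is fixed by `N`, so all nodes share the budget `nodeC M`; `At` carries the hypotheses down to
-- `n`.
module Evaluate (N w k M : ℕ) (N< : suc N < 2 ^ M) (w≤M : w ≤ M) (k≤M : k ≤ M)
                (keys≤M : (suc N * 2 ^ suc w) ^ k ≤ M) (1≤k : 1 ≤ k) (k^N< : k ^ N < 2 ^ M) where
  open Bounded M

  module At {n} (n≤N : n ≤ N) = TableProcedures n w k M
    (≤-<-trans (s≤s n≤N) N<) w≤M k≤M
    (≤-trans (^-monoˡ-≤ k (*-monoˡ-≤ (2 ^ suc w) (s≤s n≤N))) keys≤M)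

  mass< : (e : Expr w) → order ⟦ e ⟧ ≤ N → mass (tableOf k e) < 2 ^ M
  mass< e n≤N = ≤-<-trans (≤-trans (mass-tableOf k e) (^-monoʳ-≤ k {{>-nonZero 1≤k}} n≤N)) k^N<

  label-runs : ∀ {n} (n≤N : n ≤ N) (i : Fin w) → UNARY $ ⌜ toℕ i ⌝ ∷ [] ⇓ unary (toℕ i) ⟨ unaryC ⟩
  label-runs n≤N i = At.unary-runs′ n≤N (toℕ i) (≤-trans (<⇒≤ (toℕ<n i)) w≤M)

  intro≤ : suc (unaryC + (suc M + unitsC)) ≤ nodeC M
  intro≤ = proj₁ (summands unaryC (suc M) unitsC prodC relabelC joinC)

  product≤ : suc prodC ≤ nodeC M
  product≤ = proj₁ (proj₂ (summands unaryC (suc M) unitsC prodC relabelC joinC))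

  relabel≤ : suc (unaryC + (unaryC + relabelC)) ≤ nodeC M
  relabel≤ = proj₁ (proj₂ (proj₂ (summands unaryC (suc M) unitsC prodC relabelC joinC)))

  join≤ : suc (unaryC + (unaryC + joinC)) ≤ nodeC M
  join≤ = proj₂ (proj₂ (proj₂ (summands unaryC (suc M) unitsC prodC relabelC joinC)))

  eval-runs : (e : Expr w) → order ⟦ e ⟧ ≤ N →
              EVAL $ encodeExpr e ∷ unary k ∷ [] ⇓ encodeTable (tableOf k e) ⟨ size e * nodeC M ⟩
  eval-runs (intro i) n≤N = relax (≤-trans intro≤ (≤-reflexive (sym (*-identityˡ (nodeC M)))))
    (proc (label-runs n≤N i ⨾ relax (≤-trans (toℕ<n i) (≤-trans w≤M (n≤1+n M))) (single-runs (toℕ i)) ⨾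
           last (At.units-runs n≤N (1 , single (toℕ i))) refl))
  eval-runs (e ⊕ f) n≤N = relax (two-subterms (size e) (size f) (nodeC M) prodC product≤)
    (proc (eval-runs e e≤N ⨾ eval-runs f f≤N ⨾
           last (At.prod-runs n≤N (tableOf k e) (tableOf k f) [] refl
             (tableOf-Ready k e) (tableOf-Ready k f) (ready [] []) (mass< e e≤N) product<) refl))
    where
    e≤N = m+n≤o⇒m≤o (order ⟦ e ⟧) n≤N
    f≤N = m+n≤o⇒n≤o (order ⟦ e ⟧) n≤N
    -- The two masses are at most powers of `k` whose exponents add up to the order of the union.
    product< : mass (tableOf k e) * mass (tableOf k f) + mass {k} [] < 2 ^ M
    product< = ≤-<-trans (≤-trans (≤-reflexive (+-identityʳ _))
      (≤-trans (*-mono-≤ (mass-tableOf k e) (mass-tableOf k f))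
        (≤-trans (≤-reflexive (sym (^-distribˡ-+-* k (order ⟦ e ⟧) (order ⟦ f ⟧))))
          (^-monoʳ-≤ k {{>-nonZero 1≤k}} n≤N)))) k^N<
  eval-runs (relabel i j _ e) n≤N = relax (one-subterm (size e) (nodeC M) unaryC relabelC relabel≤)
    (proc (label-runs n≤N i ⨾ label-runs n≤N j ⨾ eval-runs e n≤N ⨾
           last (At.relabel-runs n≤N (toℕ i) (toℕ j) (tableOf k e) (toℕ<n j) (tableOf-Ready k e) (mass< e n≤N)) refl))
  eval-runs (join i j _ e) n≤N = relax (one-subterm (size e) (nodeC M) unaryC joinC join≤)
    (proc (label-runs n≤N i ⨾ label-runs n≤N j ⨾ eval-runs e n≤N ⨾
           last (At.join-runs n≤N (toℕ i) (toℕ j) (tableOf k e) (tableOf-Ready k e) (mass< e n≤N)) refl))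

  program-runs : ∀ {n} (G : Graph n) (e : Expr w) → e Builds G → order ⟦ e ⟧ ≤ N → size e ≤ M →
                 CountsEquitableColorings program k G e (termSize (Program.main program) + 100 * runC M)
  program-runs {n} G e builds n≤N size≤M = weaken
    (run main (input ∷ []) (At.unary-runs′ n≤N k k≤M ⨾ eval-runs e n≤N ⨾
      last (At.total-runs n≤N (tableOf k e) (tableOf-Ready k e) (mass< e n≤N)) refl))
    where
    open Program program using (main)
    open Evaluation program
    input = encodeInput k G e
    calls = unaryC + (size e * nodeC M + totalC)
    calls≤ : calls ≤ runC M
    calls≤ = +-monoʳ-≤ unaryC (+-monoˡ-≤ totalC (*-monoˡ-≤ (nodeC M) size≤M))
    weaken : ∃[ t ] t ≤ termSize main + 100 * calls × input ∷ [] ⊢ main ⇓ ⌜ total (tableOf k e) ⌝ cost t →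
             CountsEquitableColorings program k G e (termSize main + 100 * runC M)
    weaken (t , t≤ , p) = t ,
      ≤-trans t≤ (+-monoʳ-≤ (termSize main) (*-monoʳ-≤ 100 calls≤)) ,
      subst (λ c → input ∷ [] ⊢ main ⇓ ⌜ c ⌝ cost t) (sym (#equitableColorings≡total G e builds)) p

-- Polynomial bounds and the choice of `M`

PolynomiallyBounded : (ℕ → ℕ) → Set
-- For `M` at least 2 a constant factor can be absorbed into the exponent, so a single number
-- describes the bound.
PolynomiallyBounded f = ∃[ c ] ∀ M → 2 ≤ M → f M ≤ M ^ c

n<2^n : ∀ n → n < 2 ^ n
n<2^n zero    = ≤-refl
n<2^n (suc n) = ≤-trans (+-mono-≤ (m^n>0 2 n) (n<2^n n)) (≤-reflexive (cong (2 ^ n +_) (sym (+-identityʳ (2 ^ n)))))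

^-mono-2≤ : ∀ {M a b} → 2 ≤ M → a ≤ b → M ^ a ≤ M ^ b
^-mono-2≤ {M} 2≤M = ^-monoʳ-≤ M {{>-nonZero (<⇒≤ 2≤M)}}

constᵖ : ∀ c → PolynomiallyBounded (λ _ → c)
constᵖ c = c , λ M 2≤M → ≤-trans (<⇒≤ (n<2^n c)) (^-monoˡ-≤ c 2≤M)

idᵖ : PolynomiallyBounded (λ M → M)
idᵖ = 1 , λ M _ → ≤-reflexive (sym (^-identityʳ M))

infixl 6 _+ᵖ_
infixl 7 _*ᵖ_

_+ᵖ_ : ∀ {f g} → PolynomiallyBounded f → PolynomiallyBounded g → PolynomiallyBounded (λ M → f M + g M)
(a , p) +ᵖ (b , q) = suc (a + b) , λ M 2≤M → ≤-trans
  (+-mono-≤ (≤-trans (p M 2≤M) (^-mono-2≤ 2≤M (m≤m+n a b)))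
            (≤-trans (q M 2≤M) (^-mono-2≤ 2≤M (m≤n+m b a))))
  (≤-trans (≤-reflexive (cong (M ^ (a + b) +_) (sym (+-identityʳ _))))
           (*-monoˡ-≤ (M ^ (a + b)) 2≤M))

_*ᵖ_ : ∀ {f g} → PolynomiallyBounded f → PolynomiallyBounded g → PolynomiallyBounded (λ M → f M * g M)
(a , p) *ᵖ (b , q) = a + b , λ M 2≤M → ≤-trans (*-mono-≤ (p M 2≤M) (q M 2≤M))
  (≤-reflexive (sym (^-distribˡ-+-* M a b)))

sucᵖ : ∀ {f} → PolynomiallyBounded f → PolynomiallyBounded (λ M → suc (f M))
sucᵖ p = constᵖ 1 +ᵖ p

programTime : ℕ → ℕ
programTime M = termSize (Program.main program) + 100 * runC M

-- Abstract, since type checking would otherwise evaluate the exponent.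
abstract
  programTimeᵖ : PolynomiallyBounded programTime
  programTimeᵖ = constᵖ (termSize (Program.main program)) +ᵖ constᵖ 100 *ᵖ runᵖ
    where
    open Bounded
    1+M : PolynomiallyBounded suc
    1+M = sucᵖ idᵖ
    addᵖ : PolynomiallyBounded addC
    addᵖ = sucᵖ (idᵖ +ᵖ idᵖ) *ᵖ sucᵖ (idᵖ +ᵖ idᵖ)
    eqᵖ : PolynomiallyBounded eqC
    eqᵖ = sucᵖ (constᵖ 4 *ᵖ idᵖ)
    keyᵖ : PolynomiallyBounded keyC
    keyᵖ = sucᵖ (idᵖ *ᵖ sucᵖ (sucᵖ (eqᵖ +ᵖ eqᵖ)))
    mulᵖ : PolynomiallyBounded mulC
    mulᵖ = 1+M *ᵖ sucᵖ (addᵖ +ᵖ addᵖ)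
    combineᵖ : PolynomiallyBounded combineC
    combineᵖ = 1+M *ᵖ sucᵖ (addᵖ +ᵖ 1+M)
    insertᵖ : PolynomiallyBounded insertC
    insertᵖ = 1+M *ᵖ sucᵖ (keyᵖ +ᵖ addᵖ)
    rowᵖ : PolynomiallyBounded rowC
    rowᵖ = 1+M *ᵖ sucᵖ (combineᵖ +ᵖ (mulᵖ +ᵖ insertᵖ))
    prodᵖ : PolynomiallyBounded prodC
    prodᵖ = 1+M *ᵖ sucᵖ rowᵖ
    relabelSetᵖ : PolynomiallyBounded relabelSetC
    relabelSetᵖ = sucᵖ (1+M +ᵖ (1+M +ᵖ (1+M +ᵖ 1+M)))
    relabelKeyᵖ : PolynomiallyBounded relabelKeyC
    relabelKeyᵖ = 1+M *ᵖ sucᵖ relabelSetᵖ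
    relabelᵖ : PolynomiallyBounded relabelC
    relabelᵖ = 1+M *ᵖ sucᵖ (relabelKeyᵖ +ᵖ insertᵖ)
    badᵖ : PolynomiallyBounded badC
    badᵖ = 1+M *ᵖ sucᵖ (1+M +ᵖ 1+M)
    joinᵖ : PolynomiallyBounded joinC
    joinᵖ = 1+M *ᵖ sucᵖ (badᵖ +ᵖ insertᵖ)
    unaryᵖ : PolynomiallyBounded unaryC
    unaryᵖ = sucᵖ (constᵖ 3 *ᵖ idᵖ)
    unitsᵖ : PolynomiallyBounded unitsC
    unitsᵖ = 1+M *ᵖ sucᵖ (1+M +ᵖ 1+M)
    nearᵖ : PolynomiallyBounded nearC
    nearᵖ = sucᵖ (eqᵖ +ᵖ (1+M +ᵖ (eqᵖ +ᵖ (1+M +ᵖ eqᵖ))))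
    equitableᵖ : PolynomiallyBounded equitableC
    equitableᵖ = 1+M *ᵖ sucᵖ (1+M *ᵖ sucᵖ nearᵖ)
    totalᵖ : PolynomiallyBounded totalC
    totalᵖ = 1+M *ᵖ sucᵖ (equitableᵖ +ᵖ addᵖ)
    nodeᵖ : PolynomiallyBounded nodeC
    nodeᵖ = sucᵖ (unaryᵖ +ᵖ (unaryᵖ +ᵖ (1+M +ᵖ (unitsᵖ +ᵖ (prodᵖ +ᵖ (relabelᵖ +ᵖ joinᵖ))))))
    runᵖ : PolynomiallyBounded runC
    runᵖ = unaryᵖ +ᵖ (idᵖ *ᵖ nodeᵖ +ᵖ totalᵖ)

keyBound : ℕ → ℕ → ℕ → ℕ
keyBound n w k = (suc n * 2 ^ suc w) ^ k

weaken : ∀ P {n w} k (G : Graph n) (e : Expr w) {b b′} → b ≤ b′ →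
         CountsEquitableColorings P k G e b → CountsEquitableColorings P k G e b′
weaken P k G e b≤b′ (t , t≤b , p) = t , ≤-trans t≤b b≤b′ , p

x≤x^k : ∀ {x k} → 1 ≤ x → 1 ≤ k → x ≤ x ^ k
x≤x^k {x} 1≤x 1≤k = ≤-trans (≤-reflexive (sym (^-identityʳ x))) (^-monoʳ-≤ x {{>-nonZero 1≤x}} 1≤k)

module Sizes (n w k s : ℕ) (1≤k : 1 ≤ k) where

  base Q M : ℕ
  base = suc n * 2 ^ suc w
  Q    = keyBound n w k + s
  -- `Q` already exceeds `n` and bounds `k`, `w`, the table lengths and the size of the expression.
  -- The square is for the counters: `k ^ n ≤ 2 ^ (k * n)`, and `k * n < Q * Q`.
  M    = Q * Q

  2≤base : 2 ≤ base
  2≤base = *-mono-≤ {1} {suc n} {2} {2 ^ suc w} (s≤s z≤n) (^-mono-2≤ {2} {1} {suc w} ≤-refl (s≤s z≤n))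

  base≤Q : base ≤ Q
  base≤Q = ≤-trans (x≤x^k (<⇒≤ 2≤base) 1≤k) (m≤m+n (keyBound n w k) s)

  1+n≤Q : suc n ≤ Q
  1+n≤Q = ≤-trans (m≤m*n (suc n) (2 ^ suc w) {{m^n≢0 2 (suc w)}}) base≤Q

  w≤Q : w ≤ Q
  w≤Q = ≤-trans (n≤1+n w) (≤-trans (<⇒≤ (n<2^n (suc w))) (≤-trans (m≤n*m (2 ^ suc w) (suc n)) base≤Q))

  k≤Q : k ≤ Q
  k≤Q = ≤-trans (<⇒≤ (n<2^n k)) (≤-trans (^-monoˡ-≤ k 2≤base) (m≤m+n (keyBound n w k) s))

  2≤Q : 2 ≤ Q
  2≤Q = ≤-trans 2≤base base≤Q

  Q≤M : Q ≤ M
  Q≤M = m≤m*n Q Q {{>-nonZero (<⇒≤ 2≤Q)}}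

  k^n< : k ^ n < 2 ^ M
  k^n< = ≤-<-trans (≤-trans (^-monoˡ-≤ n (<⇒≤ (n<2^n k))) (≤-reflexive (^-*-assoc 2 k n)))
    (^-monoʳ-< 2 ≤-refl (≤-<-trans (*-monoˡ-≤ n k≤Q) (*-monoʳ-< Q {{>-nonZero (<⇒≤ 2≤Q)}} 1+n≤Q)))

  M^c : ∀ c → M ^ c ≡ Q ^ (c + c)
  M^c c = trans (cong (_^ c) (cong (Q *_) (sym (^-identityʳ Q))))
    (trans (^-*-assoc Q 2 c) (cong (Q ^_) (cong (c +_) (+-identityʳ c))))

program-correct : ∃[ c ] ∀ {n w} k → 1 ≤ k → (G : Graph n) (e : Expr w) → e Builds G →
                  CountsEquitableColorings program k G e ((keyBound n w k + size e) ^ c)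
-- The time is at most `M ^ c` and `M` is the square of `Q`, so the exponent doubles.
program-correct = c + c , λ {n} {w} → correct n w
  where
  c = proj₁ programTimeᵖ
  correct : ∀ n w k → 1 ≤ k → (G : Graph n) (e : Expr w) → e Builds G →
            CountsEquitableColorings program k G e ((keyBound n w k + size e) ^ (c + c))
  correct n w k 1≤k G e builds = weaken program k G e {programTime M} {Q ^ (c + c)}
    (≤-trans (proj₂ programTimeᵖ M (≤-trans 2≤Q Q≤M)) (≤-reflexive (M^c c)))
    (Evaluate.program-runs n w k M
      (≤-<-trans (≤-trans 1+n≤Q Q≤M) (n<2^n M)) (≤-trans w≤Q Q≤M) (≤-trans k≤Q Q≤M)
      (≤-trans (m≤m+n (keyBound n w k) (size e)) Q≤M) 1≤k k^n<
      G e builds (≤-reflexive (↔⇒≡ (_≅_.bijection builds)))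
      (≤-trans (m≤n+m (size e) (keyBound n w k)) Q≤M))
    where open Sizes n w k (size e) 1≤k

-- Input size and the final estimates

0<order : ∀ {w} (e : Expr w) → 0 < order ⟦ e ⟧
0<order (intro i)         = s≤s z≤n
0<order (e ⊕ f)           = ≤-trans (0<order e) (m≤m+n _ _)
0<order (relabel i j _ e) = 0<order e
0<order (join i j _ e)    = 0<order e

0<labels : ∀ {w} → Expr w → 0 < w
0<labels (intro i)         = ≤-<-trans z≤n (toℕ<n i)
0<labels (e ⊕ f)           = 0<labels e
0<labels (relabel i j _ e) = 0<labels e
0<labels (join i j _ e)    = 0<labels e

size≤treeSize : ∀ {w} (e : Expr w) → size e ≤ treeSize (encodeExpr e)
size≤treeSize (intro i)         = s≤s z≤n
size≤treeSize (e ⊕ f)           = s≤s (≤-trans (+-mono-≤ (size≤treeSize e) (size≤treeSize f))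
  (≤-trans (n≤1+n _) (m≤n+m _ (treeSize ⌜ 1 ⌝))))
size≤treeSize (relabel i j _ e) = s≤s (≤-trans (size≤treeSize e)
  (≤-trans (m≤n+m _ (treeSize ⌜ toℕ j ⌝)) (≤-trans (n≤1+n _) (≤-trans (m≤n+m _ (treeSize ⌜ toℕ i ⌝))
    (≤-trans (n≤1+n _) (m≤n+m _ (treeSize ⌜ 2 ⌝)))))))
size≤treeSize (join i j _ e)    = s≤s (≤-trans (size≤treeSize e)
  (≤-trans (m≤n+m _ (treeSize ⌜ toℕ j ⌝)) (≤-trans (n≤1+n _) (≤-trans (m≤n+m _ (treeSize ⌜ toℕ i ⌝))
    (≤-trans (n≤1+n _) (m≤n+m _ (treeSize ⌜ 3 ⌝)))))))

length<treeSize : ∀ {A : Set} (f : A → Tree) xs → length xs < treeSize (encodeList f xs)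
length<treeSize f []       = s≤s z≤n
length<treeSize f (x ∷ xs) = s≤s (≤-trans (length<treeSize f xs) (m≤n+m _ (treeSize (f x))))

order<treeSize : ∀ {n} (G : Graph n) → n < treeSize (encodeGraph G)
order<treeSize {n} G = subst (_< treeSize (encodeGraph G)) (List.length-tabulate (List.tabulate ∘ adj G))
  (length<treeSize (encodeList encodeBool) _)

module _ {n w : ℕ} (k : ℕ) (G : Graph n) (e : Expr w) where

  order<input : n < treeSize (encodeInput k G e)
  order<input = ≤-trans (order<treeSize G) (≤-trans (m≤m+n _ _) (≤-trans (n≤1+n _)
    (≤-trans (m≤n+m _ (treeSize ⌜ w ⌝)) (≤-trans (n≤1+n _) (≤-trans (m≤n+m _ (treeSize ⌜ k ⌝)) (n≤1+n _))))))

  size≤input : size e ≤ treeSize (encodeInput k G e)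
  size≤input = ≤-trans (size≤treeSize e) (≤-trans (m≤n+m _ (treeSize (encodeGraph G))) (≤-trans (n≤1+n _)
    (≤-trans (m≤n+m _ (treeSize ⌜ w ⌝)) (≤-trans (n≤1+n _) (≤-trans (m≤n+m _ (treeSize ⌜ k ⌝)) (n≤1+n _))))))

*-interchange : ∀ a b c d → a * b * (c * d) ≡ a * c * (b * d)
*-interchange = solve-∀

^-distribʳ-* : ∀ m a b → (a * b) ^ m ≡ a ^ m * b ^ m
^-distribʳ-* zero    a b = refl
^-distribʳ-* (suc m) a b =
  trans (cong (a * b *_) (^-distribʳ-* m a b)) (*-interchange a b (a ^ m) (b ^ m))

module _ {n w k : ℕ} (1≤n : 1 ≤ n) (1≤w : 1 ≤ w) (1≤k : 1 ≤ k) where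

  private
    A = 2 ^ (k * w)
    B = n ^ k
    2≤A : 2 ≤ A
    2≤A = ^-mono-2≤ {2} {1} ≤-refl (*-mono-≤ 1≤k 1≤w)
    1≤B : 1 ≤ B
    1≤B = ≤-trans 1≤n (x≤x^k 1≤n 1≤k)
    2^w≤A : 2 ^ w ≤ A
    2^w≤A = ^-mono-2≤ {2} ≤-refl (m≤n*m w k {{>-nonZero 1≤k}})
    2^k≤A : 2 ^ k ≤ A
    2^k≤A = ^-mono-2≤ {2} ≤-refl (m≤m*n k w {{>-nonZero 1≤w}})

  -- The exponent 3 arises as follows: `suc n ≤ n + n` and the successor in `2 ^ suc w` each give a
  -- factor `2 ^ k`, which is at most `A`, and `(2 ^ w) ^ k` is the third `A`.
  keyBound≤ : keyBound n w k ≤ A ^ 3 * B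
  keyBound≤ = begin
    (suc n * (2 * 2 ^ w)) ^ k ≤⟨ ^-monoˡ-≤ k (*-monoˡ-≤ (2 * 2 ^ w) (+-monoˡ-≤ n 1≤n)) ⟩
    ((n + n) * (2 * 2 ^ w)) ^ k ≡⟨ cong (_^ k) (rearrange n (2 ^ w)) ⟩
    (2 * (2 * (2 ^ w * n))) ^ k ≡⟨ ^-distribʳ-* k 2 (2 * (2 ^ w * n)) ⟩
    2 ^ k * (2 * (2 ^ w * n)) ^ k ≡⟨ cong (2 ^ k *_) (^-distribʳ-* k 2 (2 ^ w * n)) ⟩
    2 ^ k * (2 ^ k * (2 ^ w * n) ^ k) ≡⟨ cong (λ x → 2 ^ k * (2 ^ k * x)) (^-distribʳ-* k (2 ^ w) n) ⟩
    2 ^ k * (2 ^ k * ((2 ^ w) ^ k * B)) ≡⟨ cong (λ x → 2 ^ k * (2 ^ k * (x * B)))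
                                             (trans (^-*-assoc 2 w k) (cong (2 ^_) (*-comm w k))) ⟩
    2 ^ k * (2 ^ k * (A * B)) ≤⟨ *-mono-≤ 2^k≤A (*-monoˡ-≤ (A * B) 2^k≤A) ⟩
    A * (A * (A * B)) ≡⟨ collect A B ⟩
    A ^ 3 * B ∎
    where
    open ≤-Reasoning
    rearrange : ∀ n x → (n + n) * (2 * x) ≡ 2 * (2 * (x * n))
    rearrange = solve-∀
    collect : ∀ a b → a * (a * (a * b)) ≡ a * (a * (a * 1)) * b
    collect = solve-∀

  n+w≤ : n + w ≤ A * B
  n+w≤ = begin
    n + w         ≤⟨ +-monoʳ-≤ n (m≤n*m w n {{>-nonZero 1≤n}}) ⟩
    n + n * w     ≡⟨ *-suc n w ⟨
    n * suc w     ≤⟨ *-mono-≤ (x≤x^k 1≤n 1≤k) (≤-trans (n<2^n w) 2^w≤A) ⟩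
    B * A         ≡⟨ *-comm B A ⟩
    A * B ∎
    where open ≤-Reasoning

  -- Both summands are bounded by powers of 2 ^ (k * w) * n ^ k.
  time≤ : ∀ d c {s} → s ≤ d * (n + w) ^ d →
          (keyBound n w k + s) ^ c ≤ 2 ^ ((4 + d + d) * c * (k * w)) * n ^ ((4 + d + d) * c * k)
  time≤ d c {s} s≤ = begin
    -- The exponent `3 + d + d` serves both summands: 3 for the keys, and for the size one `d` from
    -- `d ≤ D ^ d` and one from `(n + w) ^ d ≤ D ^ d`. Adding the summands costs a factor 2, at most
    -- one more `D`.
    (keyBound n w k + s) ^ c ≤⟨ ^-monoˡ-≤ c (+-mono-≤ keys size≤) ⟩
    (D ^ (3 + d + d) + D ^ (3 + d + d)) ^ c ≡⟨ cong (λ x → (D ^ (3 + d + d) + x) ^ c) (sym (+-identityʳ _)) ⟩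
    (2 * D ^ (3 + d + d)) ^ c ≤⟨ ^-monoˡ-≤ c (*-monoˡ-≤ (D ^ (3 + d + d)) 2≤D) ⟩
    (D ^ (4 + d + d)) ^ c ≡⟨ ^-*-assoc D (4 + d + d) c ⟩
    D ^ ((4 + d + d) * c) ≡⟨ expand ((4 + d + d) * c) ⟩
    2 ^ ((4 + d + d) * c * (k * w)) * n ^ ((4 + d + d) * c * k) ∎
    where
    open ≤-Reasoning
    D = A * B
    2≤D : 2 ≤ D
    2≤D = *-mono-≤ {2} {A} {1} {B} 2≤A 1≤B
    A≤D : A ≤ D
    A≤D = m≤m*n A B {{>-nonZero 1≤B}}
    keys : keyBound n w k ≤ D ^ (3 + d + d)
    keys = ≤-trans keyBound≤ (≤-trans (≤-reflexive (collect A B))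
      (≤-trans (*-mono-≤ A≤D (*-mono-≤ A≤D (≤-reflexive (sym (*-identityʳ D)))))
        (^-mono-2≤ 2≤D (≤-trans (m≤m+n 3 d) (m≤m+n (3 + d) d)))))
      where
      collect : ∀ a b → a * (a * (a * 1)) * b ≡ a * (a * (a * b))
      collect = solve-∀
    size≤ : s ≤ D ^ (3 + d + d)
    size≤ = ≤-trans s≤ (≤-trans (*-mono-≤ (≤-trans (<⇒≤ (n<2^n d)) (^-monoˡ-≤ d 2≤D)) (^-monoˡ-≤ d n+w≤))
      (≤-trans (≤-reflexive (sym (^-distribˡ-+-* D d d)))
        (^-mono-2≤ 2≤D (+-monoˡ-≤ d (m≤n+m d 3)))))
    expand : ∀ m → D ^ m ≡ 2 ^ (m * (k * w)) * n ^ (m * k)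
    expand zero    = refl
    expand (suc m) = trans (cong (D *_) (expand m)) (trans (*-interchange A B _ _)
      (cong₂ _*_ (sym (^-distribˡ-+-* 2 (k * w) (m * (k * w)))) (sym (^-distribˡ-+-* n k (m * k)))))

-- Raising `s ≤ X` to `s ≤ X ^ k` lets `X ^ k` be factored out of the sum. For fixed `k`, `c` and
-- `m` the cofactor is a constant, and a power of the input size remains.
input-time≤ : ∀ {n w k c X s} m → 1 ≤ k → w ≤ c → n < X → s ≤ X →
              (keyBound n w k + s) ^ m ≤ suc ((2 ^ suc c) ^ k) ^ m * X ^ (k * m)
input-time≤ {n} {w} {k} {c} {X} {s} m 1≤k w≤c n<X s≤X = begin
  (keyBound n w k + s) ^ m
    ≤⟨ ^-monoˡ-≤ m (+-mono-≤
         (^-monoˡ-≤ k (*-mono-≤ n<X (^-mono-2≤ {2} ≤-refl (s≤s w≤c))))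
         (≤-trans s≤X (x≤x^k (≤-trans (s≤s z≤n) n<X) 1≤k))) ⟩
  ((X * 2 ^ suc c) ^ k + X ^ k) ^ m
    ≡⟨ cong (_^ m) (trans (cong (_+ X ^ k) (^-distribʳ-* k X (2 ^ suc c))) (collect (X ^ k) ((2 ^ suc c) ^ k))) ⟩
  (suc ((2 ^ suc c) ^ k) * X ^ k) ^ m
    ≡⟨ ^-distribʳ-* m (suc ((2 ^ suc c) ^ k)) (X ^ k) ⟩
  suc ((2 ^ suc c) ^ k) ^ m * (X ^ k) ^ m
    ≡⟨ cong (suc ((2 ^ suc c) ^ k) ^ m *_) (^-*-assoc X k m) ⟩
  suc ((2 ^ suc c) ^ k) ^ m * X ^ (k * m) ∎
  where
  open ≤-Reasoning
  collect : ∀ x y → x * y + x ≡ suc y * x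
  collect = solve-∀

theorem1p1 : (∃[ P ] ∀ (d : ℕ) → ∃[ a ] ∃[ b ]
    ∀ {n w} (k : ℕ) → 1 ≤ k → (G : Graph n) (e : Expr w) → e Builds G →
    size e ≤ d * (n + w) ^ d →
    CountsEquitableColorings P k G e (2 ^ (a * (k * w)) * n ^ (b * k)))
    ×
    (∀ (k : ℕ) → 1 ≤ k → (𝒢 : GraphClass) (c : ℕ) → CliqueWidthBoundedBy c 𝒢 →
    ∃[ P ] ∃[ d ]
    ∀ {n w} (G : Graph n) (e : Expr w) → 𝒢 G → w ≤ c → e Builds G →
    CountsEquitableColorings P k G e (d * treeSize (encodeInput k G e) ^ d))
theorem1p1 = general , bounded
  where
  c₀ = proj₁ program-correct
  general : ∃[ P ] ∀ (d : ℕ) → ∃[ a ] ∃[ b ]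
    ∀ {n w} (k : ℕ) → 1 ≤ k → (G : Graph n) (e : Expr w) → e Builds G →
    size e ≤ d * (n + w) ^ d →
    CountsEquitableColorings P k G e (2 ^ (a * (k * w)) * n ^ (b * k))
  general = program , λ d → (4 + d + d) * c₀ , (4 + d + d) * c₀ , λ k 1≤k G e builds size≤ →
    weaken program k G e (time≤ (subst (1 ≤_) (↔⇒≡ (_≅_.bijection builds)) (0<order e)) (0<labels e) 1≤k d c₀ size≤)
      (proj₂ program-correct k 1≤k G e builds)
  bounded : ∀ (k : ℕ) → 1 ≤ k → (𝒢 : GraphClass) (c : ℕ) → CliqueWidthBoundedBy c 𝒢 →
    ∃[ P ] ∃[ d ]
    ∀ {n w} (G : Graph n) (e : Expr w) → 𝒢 G → w ≤ c → e Builds G →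
    CountsEquitableColorings P k G e (d * treeSize (encodeInput k G e) ^ d)
  -- One number has to serve both as factor and as exponent, so the constant `C` and the exponent
  -- `k * c₀` are added.
  bounded k 1≤k 𝒢 c _ = program , C + k * c₀ , λ G e _ w≤c builds →
    weaken program k G e (≤-trans (input-time≤ c₀ 1≤k w≤c (order<input k G e) (size≤input k G e))
      (*-mono-≤ (m≤m+n C (k * c₀))
        (^-monoʳ-≤ (treeSize (encodeInput k G e)) {{>-nonZero (≤-trans (s≤s z≤n) (order<input k G e))}}
          (m≤n+m (k * c₀) C))))
      (proj₂ program-correct k 1≤k G e builds)
    where C = suc ((2 ^ suc c) ^ k) ^ c₀
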